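{- Let $a\ge 2$, $b\ge 2$ and $i\ge 0$ be integers. Then the following three sets are in bijection (in particular they have the same cardinality): (1) $\operatorname{Skyt}(a,i,b)$; (2) $\operatorname{Dyck}(a+b+2i-2,\,i+1,\,b-2)$; (3) $\operatorname{Tri}(a+b+2i,\,i+1,\,b-2)$.
   Context: Skew tableaux. For partitions $\mu\subseteq\lambda$ (written as weakly decreasing lists of row lengths, $x^t$ meaning $x$ repeated $t$ times), the skew diagram $\lambda/\mu$ consists of the boxes of the left-justified Young diagram of $\lambda$ (rows numbered top to bottom) not in that of $\mu$. A standard filling of a skew diagram with $N$ boxes uses each of $1,\dots,N$ exactly once, with rows strictly increasing left to right and columns increasing top to bottom. $\operatorname{Skyt}(a,i,b)$ is the set of standard fillings of the skew shape $[(i+1)^b,1^{a-2}]/[i^{b-2}]$; concretely, rows $1,\dots,b-2$ each contain a single box in column $i+1$, rows $b-1$ and $b$ contain boxes in columns $1,\dots,i+1$, and rows $b+1,\dots,b+a-2$ each contain a single box in column $1$ (so the first column has $a$ boxes, the last column has $b$ boxes, and there are $a+b+2i-2$ boxes in total). Dyck paths. A Dyck path of semi-length $n$ is a word in $\{\mathsf U,\mathsf D\}^{2n}$ with $n$ letters of each kind such that every initial segment contains at least as many $\mathsf U$'s as $\mathsf D$'s. An ascent is a maximal run of consecutive $\mathsf U$'s; it is a long ascent if it has length at least $2$ and a singleton if it has length $1$. $\operatorname{Dyck}(n,\ell,s)$ is the set of Dyck paths of semi-length $n$ with exactly $\ell$ long ascents and exactly $s$ singletons, such that no singleton occurs after the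 last long ascent. Triangulations. Polygons with $n$ vertices have vertices labeled $1,\dots,n$ counterclockwise. A triangulation is a subdivision of the polygon into triangles by non-crossing diagonals. For a vertex $x$ of a triangulation, the fan at $x$ is the maximal collection of triangles all containing $x$ ($x$ is its origin); a fan is singular if it consists of a single triangle. The fan sequence $\mathcal F(T)$ is defined recursively: if $T$ is a single edge, $\mathcal F(T)$ is empty; otherwise let $F$ be the fan at the vertex of $T$ with smallest label, delete that vertex and all edges incident to it, obtaining triangulated polygons (possibly single edges) $T_1,\dots,T_k$ (keeping their labels), arranged counterclockwise so that consecutive ones share exactly one vertex, and set $\mathcal F(T)=(F,\mathcal F(T_1),\dots,\mathcal F(T_k))$ (concatenated). $\operatorname{Tri}(n,t,s)$ is the set of triangulations $T$ of an $n$-gon such that $\mathcal F(T)$ consists of $s+t$ fans, exactly $s$ of which are singular, and the last fan of $\mathcal F(T)$ is not singular. -}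

module Defs where

open import Data.Bool using (Bool; true; false; _∧_; _∨_; not; if_then_else_; T)
open import Data.Nat using (ℕ; zero; suc; _+_; _*_; _∸_; _<ᵇ_; _≤ᵇ_; _≡ᵇ_)
open import Data.List using (List; []; _∷_; length; concat; concatMap; map; replicate; upTo; filterᵇ; _++_)
open import Data.Bool.ListAction using (all; any)
open import Data.Maybe using (Maybe; just; nothing)
open import Data.Product using (Σ; _×_; _,_)

elemᵇ : ℕ → List ℕ → Bool
elemᵇ x []       = false
elemᵇ x (y ∷ ys) = (x ≡ᵇ y) ∨ elemᵇ x ys

distinctᵇ : List ℕ → Bool
distinctᵇ []       = true
distinctᵇ (x ∷ xs) = not (elemᵇ x xs) ∧ distinctᵇ xs

strictIncᵇ : List ℕ → Bool
strictIncᵇ (x ∷ y ∷ xs) = (x <ᵇ y) ∧ strictIncᵇ (y ∷ xs)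
strictIncᵇ _            = true

at : List ℕ → ℕ → ℕ
at []       _       = 0
at (x ∷ xs) zero    = x
at (x ∷ xs) (suc r) = at xs r

rowAt : List (List ℕ) → ℕ → List ℕ
rowAt []       _       = []
rowAt (x ∷ xs) zero    = x
rowAt (x ∷ xs) (suc r) = rowAt xs r

lookupM : List ℕ → ℕ → Maybe ℕ
lookupM []       _       = nothing
lookupM (x ∷ xs) zero    = just x
lookupM (x ∷ xs) (suc j) = lookupM xs j

countᵇ : {A : Set} → (A → Bool) → List A → ℕ
countᵇ p []       = 0
countᵇ p (x ∷ xs) = if p x then suc (countᵇ p xs) else countᵇ p xs

-- Skew standard Young tableaux
--
-- A partition is a weakly decreasing list of row lengths (rows numbered
-- from the top, 0-indexed here; columns 0-indexed).  The cell (r , c)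
-- belongs to λ/μ iff  μ_r ≤ c < λ_r.  A filling of λ/μ is stored as a list
-- of rows; row r lists the entries of the cells (r , μ_r), (r , μ_r + 1),
-- … , (r , λ_r - 1) from left to right.

entry : List ℕ → List (List ℕ) → ℕ → ℕ → Maybe ℕ
entry μ t r c = if c <ᵇ at μ r then nothing else lookupM (rowAt t r) (c ∸ at μ r)

below<ᵇ : Maybe ℕ → Maybe ℕ → Bool
below<ᵇ (just x) (just y) = x <ᵇ y
below<ᵇ _        _        = true

hasShapeᵇ : List ℕ → List ℕ → List (List ℕ) → Bool
hasShapeᵇ λ' μ t =
  (length t ≡ᵇ length λ')
  ∧ all (λ r → length (rowAt t r) ≡ᵇ (at λ' r ∸ at μ r)) (upTo (length λ'))

rowsIncᵇ : List (List ℕ) → Bool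
rowsIncᵇ t = all strictIncᵇ t

colsIncᵇ : List ℕ → List ℕ → List (List ℕ) → Bool
colsIncᵇ λ' μ t =
  all (λ r → all (λ c → below<ᵇ (entry μ t r c) (entry μ t (suc r) c))
                 (upTo (at λ' 0)))
      (upTo (length λ'))

usesOneToNᵇ : List (List ℕ) → Bool
usesOneToNᵇ t =
  all (λ x → (1 ≤ᵇ x) ∧ (x ≤ᵇ length (concat t))) (concat t)
  ∧ distinctᵇ (concat t)

isStandardSkewᵇ : List ℕ → List ℕ → List (List ℕ) → Bool
isStandardSkewᵇ λ' μ t =
  hasShapeᵇ λ' μ t ∧ rowsIncᵇ t ∧ colsIncᵇ λ' μ t ∧ usesOneToNᵇ t

StdSkew : List ℕ → List ℕ → Set
StdSkew λ' μ = Σ (List (List ℕ)) (λ t → T (isStandardSkewᵇ λ' μ t))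

skewOuter : ℕ → ℕ → ℕ → List ℕ
skewOuter a i b = replicate b (suc i) ++ replicate (a ∸ 2) 1

skewInner : ℕ → ℕ → ℕ → List ℕ
skewInner a i b = replicate (b ∸ 2) i

Skyt : ℕ → ℕ → ℕ → Set
Skyt a i b = StdSkew (skewOuter a i b) (skewInner a i b)

data Step : Set where
  U D : Step

isU : Step → Bool
isU U = true
isU D = false

prefixOKᵇ : ℕ → List Step → Bool
prefixOKᵇ h       []      = true
prefixOKᵇ h       (U ∷ w) = prefixOKᵇ (suc h) w
prefixOKᵇ zero    (D ∷ w) = false
prefixOKᵇ (suc h) (D ∷ w) = prefixOKᵇ h w

isDyckᵇ : ℕ → List Step → Bool
isDyckᵇ n w = (length w ≡ᵇ (n + n)) ∧ (countᵇ isU w ≡ᵇ n) ∧ prefixOKᵇ 0 w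

ascentsFrom : ℕ → List Step → List ℕ
ascentsFrom zero    []      = []
ascentsFrom (suc k) []      = suc k ∷ []
ascentsFrom k       (U ∷ w) = ascentsFrom (suc k) w
ascentsFrom zero    (D ∷ w) = ascentsFrom zero w
ascentsFrom (suc k) (D ∷ w) = suc k ∷ ascentsFrom zero w

ascents : List Step → List ℕ
ascents = ascentsFrom 0

isLongᵇ : ℕ → Bool
isLongᵇ k = 2 ≤ᵇ k

isSingletonᵇ : ℕ → Bool
isSingletonᵇ k = k ≡ᵇ 1

noSingletonAfterLastLongᵇ : List ℕ → Bool
noSingletonAfterLastLongᵇ []       = true
noSingletonAfterLastLongᵇ (k ∷ ks) =
  (if isSingletonᵇ k then any isLongᵇ ks else true)
  ∧ noSingletonAfterLastLongᵇ ks

Dyck : ℕ → ℕ → ℕ → Set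
Dyck n ℓ s = Σ (List Step) (λ w →
  T ( isDyckᵇ n w
    ∧ (countᵇ isLongᵇ (ascents w) ≡ᵇ ℓ)
    ∧ (countᵇ isSingletonᵇ (ascents w) ≡ᵇ s)
    ∧ noSingletonAfterLastLongᵇ (ascents w)))

-- Triangulations of the n-gon with vertices 1 , … , n (counterclockwise)
--
-- A triangulation is given by its set of diagonals, i.e. a maximal set of
-- pairwise non-crossing diagonals, stored canonically as a list of pairs
-- (x , y) with x < y, strictly increasing in lexicographic order.

Diag : Set
Diag = ℕ × ℕ

validDiagᵇ : ℕ → Diag → Bool
validDiagᵇ n (x , y) =
  (1 ≤ᵇ x) ∧ (suc (suc x) ≤ᵇ y) ∧ (y ≤ᵇ n) ∧ not ((x ≡ᵇ 1) ∧ (y ≡ᵇ n))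

sameDiagᵇ : Diag → Diag → Bool
sameDiagᵇ (a , b) (c , d) = (a ≡ᵇ c) ∧ (b ≡ᵇ d)

crossᵇ : Diag → Diag → Bool
crossᵇ (a , b) (c , d) =
  ((a <ᵇ c) ∧ (c <ᵇ b) ∧ (b <ᵇ d)) ∨ ((c <ᵇ a) ∧ (a <ᵇ d) ∧ (d <ᵇ b))

lexLtᵇ : Diag → Diag → Bool
lexLtᵇ (a , b) (c , d) = (a <ᵇ c) ∨ ((a ≡ᵇ c) ∧ (b <ᵇ d))

sortedDiagsᵇ : List Diag → Bool
sortedDiagsᵇ (d ∷ e ∷ ds) = lexLtᵇ d e ∧ sortedDiagsᵇ (e ∷ ds)
sortedDiagsᵇ _            = true

nonCrossingᵇ : List Diag → Bool
nonCrossingᵇ []       = true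
nonCrossingᵇ (d ∷ ds) = not (any (crossᵇ d) ds) ∧ nonCrossingᵇ ds

allDiags : ℕ → List Diag
allDiags n = filterᵇ (validDiagᵇ n)
  (concatMap (λ x → map (λ y → (x , y)) (upTo (suc n))) (upTo (suc n)))

maximalᵇ : ℕ → List Diag → Bool
maximalᵇ n ds =
  all (λ e → any (sameDiagᵇ e) ds ∨ any (crossᵇ e) ds) (allDiags n)

isTriangulationᵇ : ℕ → List Diag → Bool
isTriangulationᵇ n ds =
  all (validDiagᵇ n) ds ∧ sortedDiagsᵇ ds ∧ nonCrossingᵇ ds ∧ maximalᵇ n ds

-- Fan sequence.  Every polygon occurring in the recursion has vertex set
-- an interval p , p+1 , … , q of labels (in counterclockwise order), its
-- smallest label being p; it is a single edge iff q ≤ p + 1.  The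
-- neighbours of p in it are y₀ = p+1 < y₁ < … < y_k = q (sides and
-- diagonals at p), the fan at p consists of the k triangles
-- p y_{j-1} y_j, and deleting p leaves the triangulated polygons on
-- y_{j-1} , … , y_j (j = 1 … k), in counterclockwise order.
-- A fan is recorded by its number of triangles.

edgeᵇ : List Diag → ℕ → ℕ → ℕ → Bool
edgeᵇ ds p q y = (y ≡ᵇ suc p) ∨ (y ≡ᵇ q) ∨ any (sameDiagᵇ (p , y)) ds

nbrs : List Diag → ℕ → ℕ → List ℕ
nbrs ds p q = filterᵇ (edgeᵇ ds p q) (map (λ j → suc (p + j)) (upTo (q ∸ p)))

consecutive : List ℕ → List (ℕ × ℕ)
consecutive (x ∷ y ∷ xs) = (x , y) ∷ consecutive (y ∷ xs)
consecutive _            = []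

-- fuel-bounded recursion (fuel q - p suffices)
fansFuel : ℕ → List Diag → ℕ → ℕ → List ℕ
fansFuel zero    ds p q = []
fansFuel (suc f) ds p q =
  if q ≤ᵇ suc p then []
  else (length (nbrs ds p q) ∸ 1)
       ∷ concatMap (λ { (u , v) → fansFuel f ds u v }) (consecutive (nbrs ds p q))

fanSeq : ℕ → List Diag → List ℕ
fanSeq n ds = fansFuel n ds 1 n

lastNotSingularᵇ : List ℕ → Bool
lastNotSingularᵇ []           = true
lastNotSingularᵇ (k ∷ [])     = not (isSingletonᵇ k)
lastNotSingularᵇ (_ ∷ k ∷ ks) = lastNotSingularᵇ (k ∷ ks)

Tri : ℕ → ℕ → ℕ → Set
Tri n t s = Σ (List Diag) (λ ds →
  T ( isTriangulationᵇ n ds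
    ∧ (length (fanSeq n ds) ≡ᵇ (s + t))
    ∧ (countᵇ isSingletonᵇ (fanSeq n ds) ≡ᵇ s)
    ∧ lastNotSingularᵇ (fanSeq n ds)))

{-# OPTIONS --safe #-}

-- Record for each entry 1, …, N of a skew tableau where it sits: in one of the rows above row b − 1
-- (top), in row b − 1 (one), in row b (two), or below (low).  The words so obtained are those in which
-- ones dominate twos in every prefix, no low precedes the first two and no top follows the last one.
-- A Dyck path is the list of the numbers d of U's directly before each of its D's; reading d = 1 as
-- top, d = 2 + e as one and d = 0 as a leaf, label the leaves from left to right by the
-- concatenation of the blocks two low^e of the long ascents.  This is a bijection from the paths onto
-- the words: the path stays nonnegative iff every leaf belongs to the block of an earlier ascent.
--
-- Cutting a triangulated polygon along the triangle on the edge from its first to its last vertex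
-- turns it into a binary tree, and the first return decomposition U l D r turns the tree into a Dyck
-- path whose ascents are exactly the fans.

module Submission where

open import Defs
open import Data.Bool using (Bool; true; false; T; _∧_; _∨_; not; if_then_else_)
open import Data.Bool.ListAction using (any; all)
open import Data.Bool.Properties using (T-∧; T-∨; T-irrelevant)
open import Data.Empty using (⊥; ⊥-elim)
open import Data.List using (List; []; _∷_; _++_; [_]; length; concat; concatMap; map; upTo; replicate)
open import Data.List.Properties using (∷-injective; ∷-injectiveˡ; ∷-injectiveʳ; length-++; length-replicate; length-map; ++-assoc; ++-identityʳ; ++-cancelˡ; map-injective; concat-map-[_]; concatMap-++)
open import Data.List.Membership.Propositional using (_∈_; _∉_; find; lose)
open import Data.List.Membership.DecPropositional using (_∈?_)
open import Data.List.Membership.Propositional.Properties using (∈-++⁺ˡ; ∈-++⁺ʳ; ∈-++⁻; ∈-∃++; ∈-map⁺; ∈-map⁻; ∈-concatMap⁺; ∈-filter⁺; ∈-filter⁻; ∈-upTo⁺; ∈-upTo⁻)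
open import Data.List.Relation.Binary.Pointwise using (Pointwise; []; _∷_)
open import Data.List.Relation.Unary.All as All using (All; []; _∷_)
import Data.List.Relation.Unary.All.Properties as All
open import Data.List.Relation.Unary.AllPairs as AllPairs using (AllPairs; []; _∷_)
import Data.List.Relation.Unary.AllPairs.Properties as AllPairs
open import Data.List.Relation.Unary.Any as Any using (Any; here; there)
import Data.List.Relation.Unary.Any.Properties as Any
open import Data.Maybe using (just; nothing)
open import Data.Nat using (ℕ; zero; suc; _+_; _*_; _∸_; _≤_; _<_; _≡ᵇ_; _≤ᵇ_; _<ᵇ_; z≤n; s≤s)
open import Data.Nat.Properties
open import Data.Nat.Solver using (module +-*-Solver)
open import Data.Product using (Σ; ∃; ∃₂; _×_; _,_; proj₁; proj₂)
open import Data.Product.Properties using (≡-dec)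
open import Data.Sum as Sum using (_⊎_; inj₁; inj₂; [_,_]′)
open import Data.Unit using (⊤)
open import Function.Base using (_∘_; case_of_; id)
open import Function.Bundles using (_↔_; mk↔ₛ′; Equivalence)
open import Relation.Binary.Definitions using (tri<; tri≈; tri>)
open import Relation.Binary.PropositionalEquality hiding ([_])
open import Relation.Nullary using (¬_; Dec; yes; no; contradiction)
open import Relation.Nullary.Decidable using (T?; _⊎-dec_; _×-dec_)

-- The labels of the leaves carry the only record of the sizes of the long ascents: in the word each
-- of these ascents is a bare `one`. Decoding therefore splits the sequence of all leaf labels into
-- blocks, and encoding keeps a queue of labels already promised. A block has its only `two` in
-- front. Hence the first leaf to outrun the ascents would open a new block, and would be a `two`
-- whose predecessors have used up every earlier `one`; this is why nonnegativity of the path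
-- becomes the ballot condition, while a `low` is free once some `two` has occurred. On the tableau
-- side the ballot condition compares the two long rows column by column, and the other two
-- conditions come from the last and the first column. A word has one letter for each D, so the
-- semi-length is its length, and the number of lows is what the other statistics leave over. The
-- sets consist of lists with Boolean certificates, so both bijections are given by relations
-- through a common witness, a tree or a word.

∧⁻ : ∀ {x y} → T (x ∧ y) → T x × T y
∧⁻ = Equivalence.to T-∧

∧⁺ : ∀ {x y} → T x → T y → T (x ∧ y)
∧⁺ p q = Equivalence.from T-∧ (p , q)

∨⁻ : ∀ {x y} → T (x ∨ y) → T x ⊎ T y
∨⁻ = Equivalence.to T-∨

∨⁺ : ∀ {x y} → T x ⊎ T y → T (x ∨ y)
∨⁺ = Equivalence.from T-∨

not⁻ : ∀ {x} → T (not x) → ¬ T x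
not⁻ {false} _ ()

not⁺ : ∀ {x} → ¬ T x → T (not x)
not⁺ {false} _ = _
not⁺ {true}  f = f _

Σ-T-≡ : {A : Set} {P : A → Bool} {x y : Σ A (T ∘ P)} → proj₁ x ≡ proj₁ y → x ≡ y
Σ-T-≡ {x = _ , p} {y = _ , q} refl = cong (_ ,_) (T-irrelevant p q)

-- Totality supplies the two maps and functionality makes them inverse to each other; certificates
-- of type `T` are irrelevant. Functionality is asked for all related pairs, without `P` and `Q`, so
-- the relations used below contain whatever data it depends on, such as the size of the tree.
relation-↔ : {A B : Set} {P : A → Bool} {Q : B → Bool} (R : A → B → Set) →
  (∀ a → T (P a) → ∃ λ b → T (Q b) × R a b) →
  (∀ b → T (Q b) → ∃ λ a → T (P a) × R a b) →
  (∀ {a b b′} → R a b → R a b′ → b ≡ b′) →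
  (∀ {a a′ b} → R a b → R a′ b → a ≡ a′) →
  Σ A (T ∘ P) ↔ Σ B (T ∘ Q)
relation-↔ R totalˡ totalʳ functionalˡ functionalʳ = mk↔ₛ′
  (λ (a , p) → let b , q , _ = totalˡ a p in b , q)
  (λ (b , q) → let a , p , _ = totalʳ b q in a , p)
  (λ (b , q) → let a , p , r = totalʳ b q in
     Σ-T-≡ (functionalˡ (proj₂ (proj₂ (totalˡ a p))) r))
  (λ (a , p) → let b , q , r = totalˡ a p in
     Σ-T-≡ (functionalʳ (proj₂ (proj₂ (totalʳ b q))) r))

-- The heads agree, since otherwise each would lie in the tail of the other list and so precede the
-- other. Equality of lists of diagonals, of neighbours and of positions is thereby reduced to two
-- inclusions.
sorted-unique : {A : Set} {_≺_ : A → A → Set} → (∀ {x y} → x ≺ y → ¬ y ≺ x) → (∀ {x} → ¬ x ≺ x) →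
  ∀ {xs ys} → AllPairs _≺_ xs → AllPairs _≺_ ys →
  (∀ {z} → z ∈ xs → z ∈ ys) → (∀ {z} → z ∈ ys → z ∈ xs) → xs ≡ ys
sorted-unique asym irr [] [] f g = refl
sorted-unique asym irr [] (_ ∷ _) f g = case g (here refl) of λ ()
sorted-unique asym irr (_ ∷ _) [] f g = case f (here refl) of λ ()
sorted-unique {_≺_ = _≺_} asym irr {x ∷ xs} {y ∷ ys} (px ∷ pxs) (py ∷ pys) f g with x≡y
  where
  x≡y : x ≡ y
  x≡y with f (here refl) | g (here refl)
  ... | here e  | _       = e
  ... | there _ | here e  = sym e
  ... | there a | there b = ⊥-elim (asym (All.lookup py a) (All.lookup px b))
... | refl = cong (x ∷_) (sorted-unique asym irr pxs pys
    (λ z∈ → strip (All.lookup px z∈) (f (there z∈)))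
    (λ z∈ → strip (All.lookup py z∈) (g (there z∈))))
  where
  strip : ∀ {z zs} → x ≺ z → z ∈ x ∷ zs → z ∈ zs
  strip p (here refl) = ⊥-elim (irr p)
  strip p (there q)   = q

if-true : {A : Set} {b : Bool} {x y : A} → T b → (if b then x else y) ≡ x
if-true {b = true} _ = refl

if-false : {A : Set} {b : Bool} {x y : A} → ¬ T b → (if b then x else y) ≡ y
if-false {b = true}  ¬b = contradiction _ ¬b
if-false {b = false} _  = refl

AllPairs-∷ : {A : Set} {_≺_ : A → A → Set} → (∀ {x y z} → x ≺ y → y ≺ z → x ≺ z) →
  ∀ {x y ys} → x ≺ y → AllPairs _≺_ (y ∷ ys) → AllPairs _≺_ (x ∷ y ∷ ys)
AllPairs-∷ trans x≺y (y≺ys ∷ ys≺) = (x≺y ∷ All.map (trans x≺y) y≺ys) ∷ y≺ys ∷ ys≺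

-- Dyck words

countD : List Step → ℕ
countD []      = 0
countD (U ∷ w) = countD w
countD (D ∷ w) = suc (countD w)

-- What remains of a Dyck path at height `h`. This merges the prefix test and the count of letters
-- into one predicate that admits induction.
data Balanced : ℕ → List Step → Set where
  stop : Balanced 0 []
  up   : ∀ {h w} → Balanced (suc h) w → Balanced h (U ∷ w)
  down : ∀ {h w} → Balanced h w → Balanced (suc h) (D ∷ w)

Balanced-count : ∀ {h w} → Balanced h w → h + countᵇ isU w ≡ countD w
Balanced-count stop           = refl
Balanced-count (up {h} bal)   = trans (+-suc h _) (Balanced-count bal)
Balanced-count (down bal)     = cong suc (Balanced-count bal)

Balanced⇒prefixOKᵇ : ∀ {h w} → Balanced h w → T (prefixOKᵇ h w)
Balanced⇒prefixOKᵇ stop       = _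
Balanced⇒prefixOKᵇ (up bal)   = Balanced⇒prefixOKᵇ bal
Balanced⇒prefixOKᵇ (down bal) = Balanced⇒prefixOKᵇ bal

prefixOKᵇ⇒Balanced : ∀ h w → T (prefixOKᵇ h w) → h + countᵇ isU w ≡ countD w → Balanced h w
prefixOKᵇ⇒Balanced zero    []      ok eq = stop
prefixOKᵇ⇒Balanced h       (U ∷ w) ok eq =
  up (prefixOKᵇ⇒Balanced (suc h) w ok (trans (sym (+-suc h _)) eq))
prefixOKᵇ⇒Balanced (suc h) (D ∷ w) ok eq = down (prefixOKᵇ⇒Balanced h w ok (suc-injective eq))

length≡countU+countD : ∀ w → length w ≡ countᵇ isU w + countD w
length≡countU+countD []      = refl
length≡countU+countD (U ∷ w) = cong suc (length≡countU+countD w)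
length≡countU+countD (D ∷ w) =
  trans (cong suc (length≡countU+countD w)) (sym (+-suc _ _))

isDyckᵇ⇒Balanced : ∀ n w → T (isDyckᵇ n w) → countᵇ isU w ≡ n × Balanced 0 w
isDyckᵇ⇒Balanced n w p with ∧⁻ {length w ≡ᵇ (n + n)} p
... | len , q with ∧⁻ {countᵇ isU w ≡ᵇ n} q
... | ups , ok with ≡ᵇ⇒≡ (length w) (n + n) len | ≡ᵇ⇒≡ (countᵇ isU w) n ups
... | len≡ | refl = refl , prefixOKᵇ⇒Balanced 0 w ok
  (+-cancelˡ-≡ n n _ (trans (sym len≡) (length≡countU+countD w)))

Balanced⇒isDyckᵇ : ∀ {n} w → countᵇ isU w ≡ n → Balanced 0 w → T (isDyckᵇ n w)
Balanced⇒isDyckᵇ w refl bal =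
  ∧⁺ (≡⇒≡ᵇ (length w) _ (trans (length≡countU+countD w)
       (cong (countᵇ isU w +_) (sym (Balanced-count bal)))))
     (∧⁺ (≡⇒≡ᵇ (countᵇ isU w) _ refl) (Balanced⇒prefixOKᵇ bal))

record Ascents (ℓ s : ℕ) (ks : List ℕ) : Set where
  constructor mkAscents
  field
    longs      : countᵇ isLongᵇ ks ≡ ℓ
    singletons : countᵇ isSingletonᵇ ks ≡ s
    longLast   : T (noSingletonAfterLastLongᵇ ks)

dyckᵇ : ℕ → ℕ → ℕ → List Step → Bool
dyckᵇ n ℓ s w =
  isDyckᵇ n w
  ∧ (countᵇ isLongᵇ (ascents w) ≡ᵇ ℓ)
  ∧ (countᵇ isSingletonᵇ (ascents w) ≡ᵇ s)
  ∧ noSingletonAfterLastLongᵇ (ascents w)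

dyckᵇ⁻ : ∀ n ℓ s w → T (dyckᵇ n ℓ s w) →
  countᵇ isU w ≡ n × Balanced 0 w × Ascents ℓ s (ascents w)
dyckᵇ⁻ n ℓ s w p with ∧⁻ {isDyckᵇ n w} p
... | dyck , p₁ with ∧⁻ {countᵇ isLongᵇ (ascents w) ≡ᵇ ℓ} p₁
... | longs , p₂ with ∧⁻ {countᵇ isSingletonᵇ (ascents w) ≡ᵇ s} p₂
... | singles , last =
  let ups , bal = isDyckᵇ⇒Balanced n w dyck
  in ups , bal , mkAscents (≡ᵇ⇒≡ (countᵇ isLongᵇ (ascents w)) ℓ longs)
                           (≡ᵇ⇒≡ (countᵇ isSingletonᵇ (ascents w)) s singles) last

dyckᵇ⁺ : ∀ {n ℓ s w} → countᵇ isU w ≡ n → Balanced 0 w → Ascents ℓ s (ascents w) →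
  T (dyckᵇ n ℓ s w)
dyckᵇ⁺ {ℓ = ℓ} {s} {w} ups bal (mkAscents longs singles last) =
  ∧⁺ (Balanced⇒isDyckᵇ w ups bal)
  (∧⁺ (≡⇒≡ᵇ (countᵇ isLongᵇ (ascents w)) ℓ longs)
  (∧⁺ (≡⇒≡ᵇ (countᵇ isSingletonᵇ (ascents w)) s singles) last))

consPositive : ℕ → List ℕ → List ℕ
consPositive zero    ks = ks
consPositive (suc k) ks = suc k ∷ ks

ascentsFrom-D : ∀ k w → ascentsFrom k (D ∷ w) ≡ consPositive k (ascents w)
ascentsFrom-D zero    w = refl
ascentsFrom-D (suc k) w = refl

ascentsFrom-U : ∀ k w → ascentsFrom k (U ∷ w) ≡ ascentsFrom (suc k) w
ascentsFrom-U zero    w = refl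
ascentsFrom-U (suc k) w = refl

-- Triangulated polygons as binary trees

-- edge is a single edge; tri l r is the triangle on the edge from the first to the last vertex, with
-- the polygons l and r glued to its other two sides.
data Tree : Set where
  edge : Tree
  tri  : Tree → Tree → Tree

size : Tree → ℕ
size edge      = 0
size (tri l r) = suc (size l + size r)

word : Tree → List Step
word edge      = []
word (tri l r) = U ∷ word l ++ D ∷ word r

word-tri-++ : ∀ l r w → word (tri l r) ++ w ≡ U ∷ word l ++ D ∷ (word r ++ w)
word-tri-++ l r w = cong (U ∷_) (++-assoc (word l) (D ∷ word r) w)

word-balanced : ∀ t {h w} → Balanced h w → Balanced h (word t ++ w)
word-balanced edge            bal = bal
word-balanced (tri l r) {h} {w} bal = subst (Balanced h) (sym (word-tri-++ l r w))
  (up (word-balanced l (down (word-balanced r bal))))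

countU-word : ∀ t w → countᵇ isU (word t ++ w) ≡ size t + countᵇ isU w
countU-word edge      w = refl
countU-word (tri l r) w rewrite ++-assoc (word l) (D ∷ word r) w
  | countU-word l (D ∷ word r ++ w) | countU-word r w =
  cong suc (sym (+-assoc (size l) (size r) _))

join : List Tree → List Tree
join (l ∷ r ∷ ts) = tri l r ∷ ts
join ts           = ts

-- A left inverse of `word` that reads from the right. The list holds the trees between the
-- unmatched D's of the suffix; a U takes the first two, which lie before and after its matching D.
-- If there is no matching D, `join` returns its argument as a default.
parse : List Step → List Tree
parse []      = edge ∷ []
parse (D ∷ w) = edge ∷ parse w
parse (U ∷ w) = join (parse w)

parse-word : ∀ t w → parse (word t ++ D ∷ w) ≡ t ∷ parse w
parse-word edge      w = refl
parse-word (tri l r) w rewrite ++-assoc (word l) (D ∷ word r) (D ∷ w)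
  | parse-word l (word r ++ D ∷ w) | parse-word r w = refl

word-injective : ∀ {t t′} → word t ≡ word t′ → t ≡ t′
word-injective {t} {t′} eq = ∷-injectiveˡ
  (trans (sym (parse-word t [])) (trans (cong (λ w → parse (w ++ D ∷ [])) eq) (parse-word t′ [])))

descend : List Tree → List Step
descend []       = []
descend (t ∷ ts) = D ∷ word t ++ descend ts

-- The induction needs every height: from height `h` there are `h` unmatched D's, each followed by a
-- tree, and an up step takes the first of these trees as its right child.
Balanced⇒words : ∀ {h w} → Balanced h w → ∃₂ λ t ts → length ts ≡ h × w ≡ word t ++ descend ts
Balanced⇒words stop       = edge , [] , refl , refl
Balanced⇒words (down bal) with Balanced⇒words bal
... | t , ts , refl , refl = edge , t ∷ ts , refl , refl
Balanced⇒words (up bal) with Balanced⇒words bal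
... | l , r ∷ ts , refl , refl = tri l r , ts , refl , sym (word-tri-++ l r (descend ts))

word-surjective : ∀ {w} → Balanced 0 w → ∃ λ t → w ≡ word t
word-surjective bal with Balanced⇒words bal
... | t , [] , _ , eq = t , trans eq (++-identityʳ (word t))

-- Going down left children visits exactly the triangles at the first vertex and, in the path,
-- exactly the U's of the initial run. The right children met on the way are the polygons left after
-- deleting that vertex.
spine : Tree → ℕ
spine edge      = 0
spine (tri l r) = suc (spine l)

laterFans : Tree → List ℕ
laterFans edge      = []
laterFans (tri l r) = laterFans l ++ consPositive (spine r) (laterFans r)

fans : Tree → List ℕ
fans t = consPositive (spine t) (laterFans t)

consPositive-++ : ∀ k xs ys → consPositive k (xs ++ ys) ≡ consPositive k xs ++ ys
consPositive-++ zero    xs ys = refl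
consPositive-++ (suc k) xs ys = refl

-- Here `k` counts the U's of the current run already read. The D behind `word t` is the one that
-- follows a left child in the word of its parent; it closes the run if `t` is an edge.
ascentsFrom-word : ∀ t k w →
  ascentsFrom k (word t ++ D ∷ w) ≡ consPositive (spine t + k) (laterFans t ++ ascents w)
ascentsFrom-word edge      k w = ascentsFrom-D k w
ascentsFrom-word (tri l r) k w = begin
  ascentsFrom k (word (tri l r) ++ D ∷ w)
    ≡⟨ cong (ascentsFrom k) (word-tri-++ l r (D ∷ w)) ⟩
  ascentsFrom k (U ∷ word l ++ D ∷ (word r ++ D ∷ w))
    ≡⟨ ascentsFrom-U k _ ⟩
  ascentsFrom (suc k) (word l ++ D ∷ (word r ++ D ∷ w))
    ≡⟨ ascentsFrom-word l (suc k) _ ⟩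
  consPositive (spine l + suc k) (laterFans l ++ ascents (word r ++ D ∷ w))
    ≡⟨ cong₂ consPositive (+-suc (spine l) k) (cong (laterFans l ++_) (begin
      ascents (word r ++ D ∷ w)                              ≡⟨ ascentsFrom-word r 0 w ⟩
      consPositive (spine r + 0) (laterFans r ++ ascents w)
        ≡⟨ cong (λ k → consPositive k (laterFans r ++ ascents w)) (+-identityʳ (spine r)) ⟩
      consPositive (spine r) (laterFans r ++ ascents w)
        ≡⟨ consPositive-++ (spine r) (laterFans r) (ascents w) ⟩
      fans r ++ ascents w                                    ∎)) ⟩
  consPositive (suc (spine l + k)) (laterFans l ++ (fans r ++ ascents w))
    ≡⟨ cong (consPositive (suc (spine l + k))) (++-assoc (laterFans l) (fans r) (ascents w)) ⟨
  consPositive (suc (spine l + k)) (laterFans (tri l r) ++ ascents w) ∎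
  where open ≡-Reasoning

ascentsFrom-∷ʳ-D : ∀ k w → ascentsFrom k (w ++ D ∷ []) ≡ ascentsFrom k w
ascentsFrom-∷ʳ-D zero    []      = refl
ascentsFrom-∷ʳ-D (suc k) []      = refl
ascentsFrom-∷ʳ-D zero    (U ∷ w) = ascentsFrom-∷ʳ-D 1 w
ascentsFrom-∷ʳ-D (suc k) (U ∷ w) = ascentsFrom-∷ʳ-D (suc (suc k)) w
ascentsFrom-∷ʳ-D zero    (D ∷ w) = ascentsFrom-∷ʳ-D 0 w
ascentsFrom-∷ʳ-D (suc k) (D ∷ w) = cong (suc k ∷_) (ascentsFrom-∷ʳ-D 0 w)

ascents-word : ∀ t → ascents (word t) ≡ fans t
ascents-word t = begin
  ascents (word t)                            ≡⟨ ascentsFrom-∷ʳ-D 0 (word t) ⟨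
  ascents (word t ++ D ∷ [])                  ≡⟨ ascentsFrom-word t 0 [] ⟩
  consPositive (spine t + 0) (laterFans t ++ [])
    ≡⟨ cong₂ consPositive (+-identityʳ (spine t)) (++-identityʳ (laterFans t)) ⟩
  fans t                                      ∎
  where open ≡-Reasoning

-- The polygon t placed with first vertex p has last vertex end p t.
end : ℕ → Tree → ℕ
end p edge      = suc p
end p (tri l r) = end (end p l) r

end≡ : ∀ p t → end p t ≡ suc (p + size t)
end≡ p edge      = cong suc (sym (+-identityʳ p))
end≡ p (tri l r) = begin
  end (end p l) r                    ≡⟨ end≡ (end p l) r ⟩
  suc (end p l + size r)             ≡⟨ cong (λ m → suc (m + size r)) (end≡ p l) ⟩
  suc (suc (p + size l + size r))    ≡⟨ cong (suc ∘ suc) (+-assoc p (size l) (size r)) ⟩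
  suc (suc (p + (size l + size r)))  ≡⟨ cong suc (+-suc p _) ⟨
  suc (p + size (tri l r))           ∎
  where open ≡-Reasoning

p<end : ∀ p t → p < end p t
p<end p edge      = n<1+n p
p<end p (tri l r) = <-trans (p<end p l) (p<end (end p l) r)

-- The diagonals of t together with the edge from p to end p t; the other sides are left out.
data Chord : ℕ → ℕ → ℕ → Tree → Set where
  root  : ∀ {p l r} → Chord p (end p (tri l r)) p (tri l r)
  left  : ∀ {x y p l r} → Chord x y p l → Chord x y p (tri l r)
  right : ∀ {x y p l r} → Chord x y (end p l) r → Chord x y p (tri l r)

p≤chord : ∀ {x y p t} → Chord x y p t → p ≤ x
p≤chord root                      = ≤-refl
p≤chord (left c)                  = p≤chord c
p≤chord (right {p = p} {l} c)     = ≤-trans (<⇒≤ (p<end p l)) (p≤chord c)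

chord≤end : ∀ {x y p t} → Chord x y p t → y ≤ end p t
chord≤end root                      = ≤-refl
chord≤end (left {p = p} {l} {r} c)  = ≤-trans (chord≤end c) (<⇒≤ (p<end (end p l) r))
chord≤end (right c)                 = chord≤end c

chord-long : ∀ {x y p t} → Chord x y p t → suc (suc x) ≤ y
chord-long (root {p} {l} {r}) = ≤-trans (s≤s (p<end p l)) (p<end (end p l) r)
chord-long (left c)           = chord-long c
chord-long (right c)          = chord-long c

chord< : ∀ {x y p t} → Chord x y p t → x < y
chord< c = <-trans (n<1+n _) (chord-long c)

rootChord : ∀ p t → suc (suc p) ≤ end p t → Chord p (end p t) p t
rootChord p edge      h = contradiction h (<-irrefl refl)
rootChord p (tri l r) h = root

-- Crossings of chords

Cross : ℕ → ℕ → ℕ → ℕ → Set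
Cross a b c d = (a < c × c < b × b < d) ⊎ (c < a × a < d × d < b)

-- Let m be the apex and q the last vertex. A pair on one side of m is settled by recursion. A pair
-- around m is crossed by p , m if it starts after p, and by m , q if it starts at p but ends before
-- q; otherwise it is the root. This one dichotomy yields maximality of `diags`, and it shows that a
-- diagonal crossing no chord is itself a chord.
chord-or-crosses : ∀ t {p x y} → p ≤ x → suc (suc x) ≤ y → y ≤ end p t →
  Chord x y p t ⊎ ∃₂ λ c d → Chord c d p t × Cross x y c d
chord-or-crosses edge p≤x x<y y≤q =
  contradiction (≤-trans (s≤s (s≤s p≤x)) (≤-trans x<y y≤q)) (<-irrefl refl)
chord-or-crosses (tri l r) {p} {x} {y} p≤x x<y y≤q with y ≤? end p l
... | yes y≤m = Sum.map left (λ (c , d , ch , cr) → c , d , left ch , cr)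
    (chord-or-crosses l p≤x x<y y≤m)
... | no  y≰m with end p l ≤? x
... | yes m≤x = Sum.map right (λ (c , d , ch , cr) → c , d , right ch , cr)
    (chord-or-crosses r m≤x x<y y≤q)
... | no  m≰x with m≤n⇒m<n∨m≡n p≤x
... | inj₁ p<x = inj₂ (_ , _ , left (rootChord p l (≤-trans (s≤s p<x) (≰⇒> m≰x))) ,
                       inj₂ (p<x , ≰⇒> m≰x , ≰⇒> y≰m))
... | inj₂ refl with m≤n⇒m<n∨m≡n y≤q
... | inj₂ refl = inj₁ root
... | inj₁ y<q  = inj₂ (_ , _ , right (rootChord (end p l) r (≤-trans (s≤s (≰⇒> y≰m)) y<q)) ,
                        inj₁ (p<end p l , ≰⇒> y≰m , y<q))

chords-noncrossing : ∀ {t p a b c d} → Chord a b p t → Chord c d p t →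
  a < c → c < b → b < d → ⊥
chords-noncrossing root       ch′         a<c c<b b<d = <⇒≱ b<d (chord≤end ch′)
chords-noncrossing ch@(left _)  root      a<c c<b b<d = <⇒≱ a<c (p≤chord ch)
chords-noncrossing ch@(right _) root      a<c c<b b<d = <⇒≱ a<c (p≤chord ch)
chords-noncrossing (left ch)  (left ch′)  a<c c<b b<d = chords-noncrossing ch ch′ a<c c<b b<d
chords-noncrossing (right ch) (right ch′) a<c c<b b<d = chords-noncrossing ch ch′ a<c c<b b<d
chords-noncrossing (left ch)  (right ch′) a<c c<b b<d = <⇒≱ c<b (≤-trans (chord≤end ch) (p≤chord ch′))
chords-noncrossing (right ch) (left ch′)  a<c c<b b<d =
  <-asym a<c (<-≤-trans (chord< ch′) (≤-trans (chord≤end ch′) (p≤chord ch)))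

NonCrossing : (ℕ → ℕ → Set) → Set
NonCrossing E = ∀ {a b c d} → E a b → E c d → a < c → c < b → b < d → ⊥

¬cross : ∀ {E} → NonCrossing E → ∀ {a b c d} → E a b → E c d → ¬ Cross a b c d
¬cross nc e e′ (inj₁ (p , q , r)) = nc e e′ p q r
¬cross nc e e′ (inj₂ (p , q , r)) = nc e′ e p q r

-- A non-crossing edge set determines the tree: two apexes m < m′ over p , q would give crossing
-- edges p , m′ and m , q.
tree-unique : ∀ {E} → NonCrossing E → (∀ x → E x (suc x)) → ∀ t t′ p →
  (∀ {x y} → Chord x y p t → E x y) → (∀ {x y} → Chord x y p t′ → E x y) →
  end p t ≡ end p t′ → t ≡ t′
tree-unique {E} nc side = go
  where
  base : ∀ t p → (∀ {x y} → Chord x y p t → E x y) → E p (end p t)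
  base edge      p f = side p
  base (tri l r) p f = f root
  go : ∀ t t′ p → (∀ {x y} → Chord x y p t → E x y) → (∀ {x y} → Chord x y p t′ → E x y) →
    end p t ≡ end p t′ → t ≡ t′
  go edge      edge        p f g eq = refl
  go edge      (tri l r)   p f g eq = contradiction (chord-long (root {p} {l} {r})) (<-irrefl eq)
  go (tri l r) edge        p f g eq = contradiction (chord-long (root {p} {l} {r})) (<-irrefl (sym eq))
  go (tri l r) (tri l′ r′) p f g eq with <-cmp (end p l) (end p l′)
  ... | tri< m<m′ _ _ = ⊥-elim (nc (base l′ p (g ∘ left)) (base r (end p l) (f ∘ right))
          (p<end p l) m<m′ (subst (end p l′ <_) (sym eq) (p<end (end p l′) r′)))
  ... | tri> _ _ m′<m = ⊥-elim (nc (base l p (f ∘ left)) (base r′ (end p l′) (g ∘ right))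
          (p<end p l′) m′<m (subst (end p l <_) eq (p<end (end p l) r)))
  ... | tri≈ _ m≡m′ _ = cong₂ tri (go l l′ p (f ∘ left) (g ∘ left) m≡m′)
          (go r r′ (end p l) (f ∘ right)
            (g ∘ right ∘ subst (λ m → Chord _ _ m r′) m≡m′)
            (trans eq (cong (λ m → end m r′) (sym m≡m′))))

-- Lists of diagonals

_≺_ : Diag → Diag → Set
(a , b) ≺ (c , d) = a < c ⊎ (a ≡ c × b < d)

≺-irrefl : ∀ {e} → ¬ e ≺ e
≺-irrefl = [ <-irrefl refl , <-irrefl refl ∘ proj₂ ]′

≺-trans : ∀ {e f g} → e ≺ f → f ≺ g → e ≺ g
≺-trans (inj₁ p)          (inj₁ q)          = inj₁ (<-trans p q)
≺-trans (inj₁ p)          (inj₂ (refl , _)) = inj₁ p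
≺-trans (inj₂ (refl , _)) (inj₁ q)          = inj₁ q
≺-trans (inj₂ (refl , p)) (inj₂ (refl , q)) = inj₂ (refl , <-trans p q)

≺-asym : ∀ {e f} → e ≺ f → ¬ f ≺ e
≺-asym p q = ≺-irrefl (≺-trans p q)

-- The lexicographic order puts the chords at `p` before all others, by increasing end. So the
-- chords of a left child must be split in two, with the root chord of the parent inserted between
-- them.
spokes : ℕ → Tree → List Diag
spokes p edge      = []
spokes p (tri l r) = spokes p l ++ (p , end p (tri l r)) ∷ []

inner : ℕ → Tree → List Diag
inner p edge      = []
inner p (tri l r) = inner p l ++ spokes (end p l) r ++ inner (end p l) r

chords : ℕ → Tree → List Diag
chords p t = spokes p t ++ inner p t

diags : Tree → List Diag
diags edge      = []
diags (tri l r) = chords 1 l ++ chords (end 1 l) r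

spokes⇒Chord : ∀ {x y} p t → (x , y) ∈ spokes p t → x ≡ p × Chord x y p t
spokes⇒Chord p (tri l r) e∈ with ∈-++⁻ (spokes p l) e∈
... | inj₁ e∈l         = let x≡p , c = spokes⇒Chord p l e∈l in x≡p , left c
... | inj₂ (here refl) = refl , root

inner⇒Chord : ∀ {x y} p t → (x , y) ∈ inner p t → p < x × Chord x y p t
inner⇒Chord p (tri l r) e∈ with ∈-++⁻ (inner p l) e∈
... | inj₁ e∈l = let p<x , c = inner⇒Chord p l e∈l in p<x , left c
... | inj₂ e∈r with ∈-++⁻ (spokes (end p l) r) e∈r
... | inj₁ e∈s with refl , c ← spokes⇒Chord (end p l) r e∈s = p<end p l , right c
... | inj₂ e∈i = let m<x , c = inner⇒Chord (end p l) r e∈i in <-trans (p<end p l) m<x , right c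

chords⇒Chord : ∀ {x y} p t → (x , y) ∈ chords p t → Chord x y p t
chords⇒Chord p t e∈ with ∈-++⁻ (spokes p t) e∈
... | inj₁ e∈s = proj₂ (spokes⇒Chord p t e∈s)
... | inj₂ e∈i = proj₂ (inner⇒Chord p t e∈i)

Chord⇒chords : ∀ {x y p t} → Chord x y p t → (x , y) ∈ chords p t
Chord⇒chords (root {p} {l} {r}) = ∈-++⁺ˡ (∈-++⁺ʳ (spokes p l) (here refl))
Chord⇒chords (left {p = p} {l} {r} c) with ∈-++⁻ (spokes p l) (Chord⇒chords c)
... | inj₁ e∈s = ∈-++⁺ˡ (∈-++⁺ˡ e∈s)
... | inj₂ e∈i = ∈-++⁺ʳ (spokes p (tri l r)) (∈-++⁺ˡ e∈i)
Chord⇒chords (right {p = p} {l} {r} c) =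
  ∈-++⁺ʳ (spokes p (tri l r)) (∈-++⁺ʳ (inner p l) (Chord⇒chords c))

∈-diags⁺ : ∀ {x y} t → Chord x y 1 t → ¬ (x ≡ 1 × y ≡ end 1 t) → (x , y) ∈ diags t
∈-diags⁺ (tri l r) root      ne = contradiction (refl , refl) ne
∈-diags⁺ (tri l r) (left c)  ne = ∈-++⁺ˡ (Chord⇒chords c)
∈-diags⁺ (tri l r) (right c) ne = ∈-++⁺ʳ (chords 1 l) (Chord⇒chords c)

∈-diags⁻ : ∀ {x y} t → (x , y) ∈ diags t → Chord x y 1 t × ¬ (x ≡ 1 × y ≡ end 1 t)
∈-diags⁻ (tri l r) e∈ with ∈-++⁻ (chords 1 l) e∈
... | inj₁ e∈l = let c = chords⇒Chord 1 l e∈l in left c ,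
  λ { (_ , refl) → <⇒≱ (p<end (end 1 l) r) (chord≤end c) }
... | inj₂ e∈r = let c = chords⇒Chord (end 1 l) r e∈r in right c ,
  λ { (refl , _) → <⇒≱ (p<end 1 l) (p≤chord c) }

spokes-sorted : ∀ p t → AllPairs _≺_ (spokes p t)
spokes-sorted p edge      = []
spokes-sorted p (tri l r) = AllPairs.++⁺ (spokes-sorted p l) ([] ∷ [])
  (All.tabulate λ e∈ → let x≡p , c = spokes⇒Chord p l e∈ in
    inj₂ (x≡p , ≤-<-trans (chord≤end c) (p<end (end p l) r)) ∷ [])

inner-sorted : ∀ p t → AllPairs _≺_ (inner p t)
chords-sorted : ∀ p t → AllPairs _≺_ (chords p t)

inner-sorted p edge      = []
inner-sorted p (tri l r) = AllPairs.++⁺ (inner-sorted p l)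
  (AllPairs.++⁺ (spokes-sorted (end p l) r) (inner-sorted (end p l) r)
    (All.tabulate λ e∈ → All.tabulate λ f∈ →
      inj₁ (subst (_< _) (sym (proj₁ (spokes⇒Chord (end p l) r e∈)))
        (proj₁ (inner⇒Chord (end p l) r f∈)))))
  (All.tabulate λ e∈ → All.tabulate λ f∈ →
    let c = proj₂ (inner⇒Chord p l e∈) in
    inj₁ (<-≤-trans (chord< c) (≤-trans (chord≤end c) (p≤chord (chords⇒Chord (end p l) r f∈)))))

chords-sorted p t = AllPairs.++⁺ (spokes-sorted p t) (inner-sorted p t)
  (All.tabulate λ e∈ → All.tabulate λ f∈ →
    inj₁ (subst (_< _) (sym (proj₁ (spokes⇒Chord p t e∈))) (proj₁ (inner⇒Chord p t f∈))))

diags-sorted : ∀ t → AllPairs _≺_ (diags t)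
diags-sorted edge      = []
diags-sorted (tri l r) = AllPairs.++⁺ (chords-sorted 1 l) (chords-sorted (end 1 l) r)
  (All.tabulate λ e∈ → All.tabulate λ f∈ →
    let c = chords⇒Chord 1 l e∈ in
    inj₁ (<-≤-trans (chord< c) (≤-trans (chord≤end c) (p≤chord (chords⇒Chord (end 1 l) r f∈)))))

-- Reflection of the Boolean tests on diagonals

lexLtᵇ⁻ : ∀ d e → T (lexLtᵇ d e) → d ≺ e
lexLtᵇ⁻ (a , b) (c , d) p = Sum.map (<ᵇ⇒< a c)
  (λ q → let a≡c , b<d = ∧⁻ {a ≡ᵇ c} q in ≡ᵇ⇒≡ a c a≡c , <ᵇ⇒< b d b<d) (∨⁻ {a <ᵇ c} p)

lexLtᵇ⁺ : ∀ {d e} → d ≺ e → T (lexLtᵇ d e)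
lexLtᵇ⁺ {a , b} {c , d} p = ∨⁺ {a <ᵇ c} (Sum.map <⇒<ᵇ
  (λ (a≡c , b<d) → ∧⁺ (≡⇒≡ᵇ a c a≡c) (<⇒<ᵇ b<d)) p)

sortedDiagsᵇ⁻ : ∀ ds → T (sortedDiagsᵇ ds) → AllPairs _≺_ ds
sortedDiagsᵇ⁻ []           p = []
sortedDiagsᵇ⁻ (d ∷ [])     p = [] ∷ []
sortedDiagsᵇ⁻ (d ∷ e ∷ ds) p = let d≺e , q = ∧⁻ {lexLtᵇ d e} p in
  AllPairs-∷ ≺-trans (lexLtᵇ⁻ d e d≺e) (sortedDiagsᵇ⁻ (e ∷ ds) q)

sortedDiagsᵇ⁺ : ∀ {ds} → AllPairs _≺_ ds → T (sortedDiagsᵇ ds)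
sortedDiagsᵇ⁺ []                        = _
sortedDiagsᵇ⁺ (_ ∷ [])                  = _
sortedDiagsᵇ⁺ ((d≺e ∷ _) ∷ e≺ds ∷ ds≺) = ∧⁺ (lexLtᵇ⁺ d≺e) (sortedDiagsᵇ⁺ (e≺ds ∷ ds≺))

sameDiagᵇ⁻ : ∀ d e → T (sameDiagᵇ d e) → d ≡ e
sameDiagᵇ⁻ (a , b) (c , d) p = let q , r = ∧⁻ {a ≡ᵇ c} p in cong₂ _,_ (≡ᵇ⇒≡ a c q) (≡ᵇ⇒≡ b d r)

sameDiagᵇ-refl : ∀ d → T (sameDiagᵇ d d)
sameDiagᵇ-refl (a , b) = ∧⁺ (≡⇒≡ᵇ a a refl) (≡⇒≡ᵇ b b refl)

any-sameDiagᵇ⁻ : ∀ d ds → T (any (sameDiagᵇ d) ds) → d ∈ ds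
any-sameDiagᵇ⁻ d ds p = Any.map (λ {e} → sameDiagᵇ⁻ d e) (Any.any⁻ (sameDiagᵇ d) ds p)

any-sameDiagᵇ⁺ : ∀ {d ds} → d ∈ ds → T (any (sameDiagᵇ d) ds)
any-sameDiagᵇ⁺ {d} d∈ = Any.any⁺ (sameDiagᵇ d) (Any.map (λ { refl → sameDiagᵇ-refl d }) d∈)

crossᵇ⁻ : ∀ a b c d → T (crossᵇ (a , b) (c , d)) → Cross a b c d
crossᵇ⁻ a b c d p = Sum.map
  (λ q → let q₁ , q′ = ∧⁻ {a <ᵇ c} q ; q₂ , q₃ = ∧⁻ {c <ᵇ b} q′ in
    <ᵇ⇒< a c q₁ , <ᵇ⇒< c b q₂ , <ᵇ⇒< b d q₃)
  (λ q → let q₁ , q′ = ∧⁻ {c <ᵇ a} q ; q₂ , q₃ = ∧⁻ {a <ᵇ d} q′ in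
    <ᵇ⇒< c a q₁ , <ᵇ⇒< a d q₂ , <ᵇ⇒< d b q₃)
  (∨⁻ {(a <ᵇ c) ∧ (c <ᵇ b) ∧ (b <ᵇ d)} p)

crossᵇ⁺ : ∀ {a b c d} → Cross a b c d → T (crossᵇ (a , b) (c , d))
crossᵇ⁺ {a} {b} {c} {d} p = ∨⁺ {(a <ᵇ c) ∧ (c <ᵇ b) ∧ (b <ᵇ d)} (Sum.map
  (λ (q₁ , q₂ , q₃) → ∧⁺ (<⇒<ᵇ q₁) (∧⁺ (<⇒<ᵇ q₂) (<⇒<ᵇ q₃)))
  (λ (q₁ , q₂ , q₃) → ∧⁺ (<⇒<ᵇ q₁) (∧⁺ (<⇒<ᵇ q₂) (<⇒<ᵇ q₃))) p)

Joined : List Diag → ℕ → ℕ → Set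
Joined ds x y = (x , y) ∈ ds

nonCrossingᵇ⁻ : ∀ ds → T (nonCrossingᵇ ds) → NonCrossing (Joined ds)
nonCrossingᵇ⁻ (e ∷ ds) p (here refl) (here refl) a<c _ _ = <-irrefl refl a<c
nonCrossingᵇ⁻ (e ∷ ds) p (here refl) (there g) a<c c<b b<d =
  not⁻ (proj₁ (∧⁻ p)) (Any.any⁺ (crossᵇ e) (lose g (crossᵇ⁺ (inj₁ (a<c , c<b , b<d)))))
nonCrossingᵇ⁻ (e ∷ ds) p (there f) (here refl) a<c c<b b<d =
  not⁻ (proj₁ (∧⁻ p)) (Any.any⁺ (crossᵇ e) (lose f (crossᵇ⁺ (inj₂ (a<c , c<b , b<d)))))
nonCrossingᵇ⁻ (e ∷ ds) p (there f) (there g) =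
  nonCrossingᵇ⁻ ds (proj₂ (∧⁻ {not (any (crossᵇ e) ds)} p)) f g

nonCrossingᵇ⁺ : ∀ ds → NonCrossing (Joined ds) → T (nonCrossingᵇ ds)
nonCrossingᵇ⁺ []       nc = _
nonCrossingᵇ⁺ ((a , b) ∷ ds) nc = ∧⁺ (not⁺ λ p →
    let (c , d) , g , cr = find (Any.any⁻ (crossᵇ (a , b)) ds p)
    in ¬cross nc (here refl) (there g) (crossᵇ⁻ a b c d cr))
  (nonCrossingᵇ⁺ ds (λ f g → nc (there f) (there g)))

Valid : ℕ → ℕ → ℕ → Set
Valid n x y = 1 ≤ x × suc (suc x) ≤ y × y ≤ n × ¬ (x ≡ 1 × y ≡ n)

validDiagᵇ⁻ : ∀ n x y → T (validDiagᵇ n (x , y)) → Valid n x y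
validDiagᵇ⁻ n x y p with ∧⁻ {1 ≤ᵇ x} p
... | 1≤x , p₁ with ∧⁻ {suc (suc x) ≤ᵇ y} p₁
... | x<y , p₂ with ∧⁻ {y ≤ᵇ n} p₂
... | y≤n , p₃ = ≤ᵇ⇒≤ 1 x 1≤x , ≤ᵇ⇒≤ (suc (suc x)) y x<y , ≤ᵇ⇒≤ y n y≤n ,
  λ (x≡1 , y≡n) → not⁻ p₃ (∧⁺ (≡⇒≡ᵇ x 1 x≡1) (≡⇒≡ᵇ y n y≡n))

validDiagᵇ⁺ : ∀ n x y → Valid n x y → T (validDiagᵇ n (x , y))
validDiagᵇ⁺ n x y (1≤x , x<y , y≤n , ne) =
  ∧⁺ (≤⇒≤ᵇ 1≤x) (∧⁺ (≤⇒≤ᵇ x<y) (∧⁺ (≤⇒≤ᵇ y≤n) (not⁺ λ p →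
    let q , r = ∧⁻ {x ≡ᵇ 1} p in ne (≡ᵇ⇒≡ x 1 q , ≡ᵇ⇒≡ y n r))))

∈-allDiags : ∀ {n x y} → Valid n x y → (x , y) ∈ allDiags n
∈-allDiags {n} {x} {y} v@(_ , x<y , y≤n , _) = ∈-filter⁺ (T? ∘ validDiagᵇ n)
  (∈-concatMap⁺ (λ x → map (x ,_) (upTo (suc n)))
    (lose (∈-upTo⁺ (s≤s x≤n)) (∈-map⁺ (x ,_) (∈-upTo⁺ (s≤s y≤n)))))
  (validDiagᵇ⁺ n x y v)
  where x≤n = ≤-trans (≤-trans (≤-trans (n≤1+n x) (n≤1+n (suc x))) x<y) y≤n

record Triangulation (n : ℕ) (ds : List Diag) : Set where
  constructor triangulation
  field
    valid       : ∀ {x y} → (x , y) ∈ ds → Valid n x y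
    sorted      : AllPairs _≺_ ds
    nonCrossing : NonCrossing (Joined ds)
    maximal     : ∀ {x y} → Valid n x y →
                  (x , y) ∈ ds ⊎ ∃₂ λ c d → (c , d) ∈ ds × Cross x y c d

isTriangulationᵇ⁻ : ∀ n ds → T (isTriangulationᵇ n ds) → Triangulation n ds
isTriangulationᵇ⁻ n ds p with ∧⁻ {all (validDiagᵇ n) ds} p
... | valid , p₁ with ∧⁻ {sortedDiagsᵇ ds} p₁
... | sorted , p₂ with ∧⁻ {nonCrossingᵇ ds} p₂
... | nonCrossing , maximal = triangulation
  (λ e∈ → validDiagᵇ⁻ n _ _ (All.lookup (All.all⁺ (validDiagᵇ n) ds valid) e∈))
  (sortedDiagsᵇ⁻ ds sorted)
  (nonCrossingᵇ⁻ ds nonCrossing)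
  λ {x} {y} v → Sum.map (any-sameDiagᵇ⁻ (x , y) ds)
    (λ q → let (c , d) , f , cr = find (Any.any⁻ (crossᵇ (x , y)) ds q) in
      c , d , f , crossᵇ⁻ x y c d cr)
    (∨⁻ {any (sameDiagᵇ (x , y)) ds}
      (All.lookup (All.all⁺ (λ e → any (sameDiagᵇ e) ds ∨ any (crossᵇ e) ds) (allDiags n) maximal)
        (∈-allDiags v)))

isTriangulationᵇ⁺ : ∀ {n ds} → Triangulation n ds → T (isTriangulationᵇ n ds)
isTriangulationᵇ⁺ {n} {ds} (triangulation valid sorted nonCrossing maximal) =
  ∧⁺ (All.all⁻ (validDiagᵇ n) (All.tabulate (λ e∈ → validDiagᵇ⁺ n _ _ (valid e∈))))
  (∧⁺ (sortedDiagsᵇ⁺ sorted)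
  (∧⁺ (nonCrossingᵇ⁺ ds nonCrossing)
  (All.all⁻ (λ e → any (sameDiagᵇ e) ds ∨ any (crossᵇ e) ds) (All.tabulate λ {e} e∈ →
    ∨⁺ {any (sameDiagᵇ e) ds} (Sum.map any-sameDiagᵇ⁺
      (λ (c , d , f , cr) → Any.any⁺ (crossᵇ e) (lose f (crossᵇ⁺ cr)))
      (maximal (validDiagᵇ⁻ n _ _ (proj₂ (∈-filter⁻ (T? ∘ validDiagᵇ n)
        {xs = concatMap (λ x → map (x ,_) (upTo (suc n))) (upTo (suc n))} e∈)))))))))

diags-triangulation : ∀ t → Triangulation (end 1 t) (diags t)
diags-triangulation t = triangulation
  (λ e∈ → let c , ne = ∈-diags⁻ t e∈ in p≤chord c , chord-long c , chord≤end c , ne)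
  (diags-sorted t)
  (λ e∈ f∈ → chords-noncrossing (proj₁ (∈-diags⁻ t e∈)) (proj₁ (∈-diags⁻ t f∈)))
  (λ (1≤x , x<y , y≤n , ne) → Sum.map (λ c → ∈-diags⁺ t c ne)
    (λ (c , d , ch , cr) → c , d , ∈-diags⁺ t ch (avoids 1≤x y≤n cr) , cr)
    (chord-or-crosses t 1≤x x<y y≤n))
  where
  -- The chord found might be the outer edge, which is not a diagonal; but that edge encloses all
  -- vertices and crosses nothing.
  avoids : ∀ {x y c d} → 1 ≤ x → y ≤ end 1 t → Cross x y c d → ¬ (c ≡ 1 × d ≡ end 1 t)
  avoids 1≤x y≤n (inj₁ (x<c , _ , _)) (refl , refl) = <⇒≱ x<c 1≤x
  avoids 1≤x y≤n (inj₂ (_ , _ , d<y)) (refl , refl) = <⇒≱ d<y y≤n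

-- From a triangulation to its tree

Edge : ℕ → List Diag → ℕ → ℕ → Set
Edge n ds x y = y ≡ suc x ⊎ (x ≡ 1 × y ≡ n) ⊎ (x , y) ∈ ds

module _ {n : ℕ} {ds : List Diag} (Δ : Triangulation n ds) where
  open Triangulation Δ

  edges-nonCrossing : NonCrossing (Edge n ds)
  edges-nonCrossing (inj₁ refl) _ a<c c<b b<d = <⇒≱ a<c (≤-pred c<b)
  edges-nonCrossing (inj₂ _) (inj₁ refl) a<c c<b b<d = <⇒≱ c<b (≤-pred b<d)
  edges-nonCrossing (inj₂ (inj₁ (refl , refl))) (inj₂ (inj₁ (refl , refl))) a<c c<b b<d = <-irrefl refl b<d
  edges-nonCrossing (inj₂ (inj₁ (refl , refl))) (inj₂ (inj₂ f)) a<c c<b b<d =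
    let _ , _ , d≤n , _ = valid f in <⇒≱ b<d d≤n
  edges-nonCrossing (inj₂ (inj₂ e)) (inj₂ (inj₁ (refl , refl))) a<c c<b b<d = <⇒≱ a<c (proj₁ (valid e))
  edges-nonCrossing (inj₂ (inj₂ e)) (inj₂ (inj₂ f)) = nonCrossing e f

  edge? : ∀ x y → Dec (Edge n ds x y)
  edge? x y = (y ≟ suc x) ⊎-dec ((x ≟ 1) ×-dec (y ≟ n)) ⊎-dec _∈?_ (≡-dec _≟_ _≟_) (x , y) ds

  -- A search downwards from `j`. It stops at `suc p` at the latest, because that vertex is joined
  -- to `p` by a side.
  furthest : ∀ p j → p < j → ∃ λ m → p < m × m ≤ j × Edge n ds p m ×
    (∀ {y} → m < y → y ≤ j → ¬ Edge n ds p y)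
  furthest p (suc j) (s≤s p≤j) with edge? p (suc j)
  ... | yes e = suc j , s≤s p≤j , ≤-refl , e , λ m<y y≤j → contradiction y≤j (<⇒≱ m<y)
  ... | no ¬e with m≤n⇒m<n∨m≡n p≤j
  ... | inj₂ refl = contradiction (inj₁ refl) ¬e
  ... | inj₁ p<j with furthest p j p<j
  ... | m , p<m , m≤j , e , far = m , p<m , m≤n⇒m≤1+n m≤j , e ,
    λ {y} m<y y≤1+j e′ → case m≤n⇒m<n∨m≡n y≤1+j of λ where
      (inj₁ y<1+j) → far m<y (≤-pred y<1+j) e′
      (inj₂ refl)  → ¬e e′

  -- The apex over p , q is the last neighbour m of p before q: whatever crosses m , q would
  -- cross p , q or p , m, or be a later neighbour of p.
  apex-edge : ∀ {p q m} → 1 ≤ p → p < m → m < q → q ≤ n → Edge n ds p q → Edge n ds p m →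
    (∀ {y} → m < y → y < q → ¬ Edge n ds p y) → Edge n ds m q
  apex-edge {p} {q} {m} 1≤p p<m m<q q≤n pq pm far with m≤n⇒m<n∨m≡n m<q
  ... | inj₂ refl = inj₁ refl
  ... | inj₁ 1+m<q
    with maximal {m} {q} (≤-trans 1≤p (<⇒≤ p<m) , 1+m<q , q≤n , λ { (refl , _) → <⇒≱ p<m 1≤p })
  ... | inj₁ e = inj₂ (inj₂ e)
  ... | inj₂ (c , d , e , inj₁ (m<c , c<q , q<d)) =
    ⊥-elim (edges-nonCrossing pq (inj₂ (inj₂ e)) (<-trans p<m m<c) c<q q<d)
  ... | inj₂ (c , d , e , inj₂ (c<m , m<d , d<q)) with <-cmp c p
  ... | tri< c<p _ _ = ⊥-elim (edges-nonCrossing (inj₂ (inj₂ e)) pq c<p (<-trans p<m m<d) d<q)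
  ... | tri≈ _ refl _ = ⊥-elim (far m<d d<q (inj₂ (inj₂ e)))
  ... | tri> _ _ p<c = ⊥-elim (edges-nonCrossing pm (inj₂ (inj₂ e)) p<c c<m m<d)

  -- The fuel `g` bounds the distance of the end points, which drops on both sides of the apex. With
  -- the last vertex written as `suc q`, the apex is sought up to `q`, so that the base itself is
  -- not found.
  polygon : ∀ g {p q} → q ≤ g + p → 1 ≤ p → p < q → q ≤ n → Edge n ds p q →
    ∃ λ t → end p t ≡ q × (∀ {x y} → Chord x y p t → Edge n ds x y)
  polygon zero    q≤p 1≤p p<q q≤n pq = contradiction q≤p (<⇒≱ p<q)
  polygon (suc g) {p} {suc q} q≤ 1≤p (s≤s p≤q) q≤n pq with m≤n⇒m<n∨m≡n p≤q
  ... | inj₂ refl = edge , refl , λ ()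
  ... | inj₁ p<q with furthest p q p<q
  ... | m , p<m , m≤q , pm , far
    with polygon g {p} {m} (≤-trans m≤q (≤-pred q≤)) 1≤p p<m (≤-trans (m≤n⇒m≤1+n m≤q) q≤n) pm
       | polygon g {m} {suc q} (≤-trans q≤ (≤-trans (≤-reflexive (sym (+-suc g p))) (+-monoʳ-≤ g p<m)))
           (≤-trans 1≤p (<⇒≤ p<m)) (s≤s m≤q) q≤n
           (apex-edge 1≤p p<m (s≤s m≤q) q≤n pq pm (λ m<y y<q → far m<y (≤-pred y<q)))
  ... | l , refl , inl | r , eq , inr = tri l r , eq , inTri
    where
    inTri : ∀ {x y} → Chord x y p (tri l r) → Edge n ds x y
    inTri root      = subst (Edge n ds p) (sym eq) pq
    inTri (left c)  = inl c
    inTri (right c) = inr c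

  -- All chords of the tree are edges by construction. Conversely a diagonal of `ds` crosses none of
  -- these edges, so `chord-or-crosses` leaves only that it is a chord.
  chordTree : 2 ≤ n → ∃ λ t → end 1 t ≡ n × ds ≡ diags t
  chordTree 2≤n with polygon n {1} {n} (m≤m+n n 1) ≤-refl 2≤n ≤-refl (inj₂ (inj₁ (refl , refl)))
  ... | t , refl , edges = t , refl , sorted-unique ≺-asym ≺-irrefl sorted (diags-sorted t) to from
    where
    to : ∀ {e} → e ∈ ds → e ∈ diags t
    to {x , y} e∈ with valid e∈
    ... | 1≤x , x<y , y≤n , ne with chord-or-crosses t 1≤x x<y y≤n
    ... | inj₁ c = ∈-diags⁺ t c ne
    ... | inj₂ (_ , _ , c , cr) = ⊥-elim (¬cross edges-nonCrossing (inj₂ (inj₂ e∈)) (edges c) cr)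
    from : ∀ {e} → e ∈ diags t → e ∈ ds
    from {x , y} e∈ with ∈-diags⁻ t e∈
    ... | c , ne with edges c
    ... | inj₁ refl       = contradiction (chord-long c) (<-irrefl refl)
    ... | inj₂ (inj₁ eqs) = contradiction eqs ne
    ... | inj₂ (inj₂ e∈′) = e∈′

-- The number of vertices has to be known: neither `edge` nor `tri edge edge` has a diagonal.
diags-injective : ∀ {t t′} → end 1 t ≡ end 1 t′ → diags t ≡ diags t′ → t ≡ t′
diags-injective {t} {t′} end≡ eq =
  tree-unique (edges-nonCrossing (diags-triangulation t)) (λ _ → inj₁ refl) t t′ 1
    (λ c → chord⇒edge t c)
    (λ c → subst₂ (λ n ds → Edge n ds _ _) (sym end≡) (sym eq) (chord⇒edge t′ c)) end≡
  where
  chord⇒edge : ∀ t {x y} → Chord x y 1 t → Edge (end 1 t) (diags t) x y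
  chord⇒edge t {x} {y} c with (x ≟ 1) ×-dec (y ≟ end 1 t)
  ... | yes eqs = inj₂ (inj₁ eqs)
  ... | no ne   = inj₂ (inj₂ (∈-diags⁺ t c ne))

-- Fans

-- The neighbours of `p` without the last one. Their number is that of the triangles in the fan, and
-- with this split `neighbours p (tri l r)` is by definition `neighbours p l` with one more vertex
-- at the end.
rim : ℕ → Tree → List ℕ
rim p edge      = []
rim p (tri l r) = rim p l ++ end p l ∷ []

neighbours : ℕ → Tree → List ℕ
neighbours p t = rim p t ++ end p t ∷ []

length-rim : ∀ p t → length (rim p t) ≡ spine t
length-rim p edge      = refl
length-rim p (tri l r) = trans (length-++ (rim p l)) (trans (+-comm _ 1) (cong suc (length-rim p l)))

∈-neighbours⁻ : ∀ {y} p t → y ∈ neighbours p t → y ≡ suc p ⊎ Chord p y p t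
∈-neighbours⁻ p edge      (here refl) = inj₁ refl
∈-neighbours⁻ p (tri l r) y∈ with ∈-++⁻ (neighbours p l) y∈
... | inj₁ y∈l         = Sum.map₂ left (∈-neighbours⁻ p l y∈l)
... | inj₂ (here refl) = inj₂ root

suc∈neighbours : ∀ p t → suc p ∈ neighbours p t
suc∈neighbours p edge      = here refl
suc∈neighbours p (tri l r) = ∈-++⁺ˡ (suc∈neighbours p l)

Chord⇒neighbours : ∀ {y} p t → Chord p y p t → y ∈ neighbours p t
Chord⇒neighbours p (tri l r) root      = ∈-++⁺ʳ (neighbours p l) (here refl)
Chord⇒neighbours p (tri l r) (left c)  = ∈-++⁺ˡ (Chord⇒neighbours p l c)
Chord⇒neighbours p (tri l r) (right c) = contradiction (p≤chord c) (<⇒≱ (p<end p l))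

neighbours-bounds : ∀ {y} p t → y ∈ neighbours p t → p < y × y ≤ end p t
neighbours-bounds p t y∈ with ∈-neighbours⁻ p t y∈
... | inj₁ refl = n<1+n p , p<end p t
... | inj₂ c    = chord< c , chord≤end c

neighbours-sorted : ∀ p t → AllPairs _<_ (neighbours p t)
neighbours-sorted p edge      = [] ∷ []
neighbours-sorted p (tri l r) = AllPairs.++⁺ (neighbours-sorted p l) ([] ∷ [])
  (All.tabulate λ y∈ → ≤-<-trans (proj₂ (neighbours-bounds p l y∈)) (p<end (end p l) r) ∷ [])

∈-nbrs⁻ : ∀ {ds p q y} → p ≤ q → y ∈ nbrs ds p q →
  p < y × y ≤ q × (y ≡ suc p ⊎ y ≡ q ⊎ (p , y) ∈ ds)
∈-nbrs⁻ {ds} {p} {q} {y} p≤q y∈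
  with ∈-filter⁻ (T? ∘ edgeᵇ ds p q) {xs = map (λ j → suc (p + j)) (upTo (q ∸ p))} y∈
... | y∈range , isEdge with ∈-map⁻ (λ j → suc (p + j)) y∈range
... | j , j∈ , refl = s≤s (m≤m+n p j) ,
  subst (p + j <_) (m+[n∸m]≡n p≤q) (+-monoʳ-< p (∈-upTo⁻ j∈)) ,
  Sum.map (≡ᵇ⇒≡ y (suc p)) (Sum.map (≡ᵇ⇒≡ y q) (any-sameDiagᵇ⁻ (p , y) ds) ∘ ∨⁻ {y ≡ᵇ q})
    (∨⁻ {y ≡ᵇ suc p} isEdge)

∈-nbrs⁺ : ∀ {ds p q y} → p < y → y ≤ q → y ≡ suc p ⊎ y ≡ q ⊎ (p , y) ∈ ds → y ∈ nbrs ds p q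
∈-nbrs⁺ {ds} {p} {q} {y} p<y y≤q isEdge = ∈-filter⁺ (T? ∘ edgeᵇ ds p q)
  (subst (_∈ map (λ j → suc (p + j)) (upTo (q ∸ p))) (m+[n∸m]≡n p<y)
    (∈-map⁺ (λ j → suc (p + j)) (∈-upTo⁺ (+-cancelˡ-< p _ _
      (subst₂ _≤_ (sym (m+[n∸m]≡n p<y)) (sym (m+[n∸m]≡n (≤-trans (<⇒≤ p<y) y≤q))) y≤q)))))
  (∨⁺ {y ≡ᵇ suc p} (Sum.map (≡⇒≡ᵇ y (suc p))
    (∨⁺ {y ≡ᵇ q} ∘ Sum.map (≡⇒≡ᵇ y q) any-sameDiagᵇ⁺) isEdge))

nbrs-sorted : ∀ ds p q → AllPairs _<_ (nbrs ds p q)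
nbrs-sorted ds p q = AllPairs.filter⁺ (T? ∘ edgeᵇ ds p q)
  (AllPairs.map⁺ (AllPairs.applyUpTo⁺₁ id (q ∸ p) (λ i<j _ → s≤s (+-monoʳ-< p i<j))))

consecutive-∷ʳ : ∀ xs y z →
  consecutive (xs ++ y ∷ z ∷ []) ≡ consecutive (xs ++ y ∷ []) ++ (y , z) ∷ []
consecutive-∷ʳ []           y z = refl
consecutive-∷ʳ (x ∷ [])     y z = refl
consecutive-∷ʳ (x ∷ v ∷ xs) y z = cong ((x , v) ∷_) (consecutive-∷ʳ (v ∷ xs) y z)

-- The exception is for the whole polygon, whose root chord is a side and so not in the list. In
-- both children of a triangle every chord is in the list.
Fits : List Diag → ℕ → Tree → Set
Fits ds p t = ∀ {x y} → Chord x y p t → (x ≡ p × y ≡ end p t) ⊎ (x , y) ∈ ds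

Fits-left : ∀ {ds p l r} → Fits ds p (tri l r) → Fits ds p l
Fits-left {p = p} {l} {r} fits c with fits (left c)
... | inj₁ (_ , refl) = contradiction (chord≤end c) (<⇒≱ (p<end (end p l) r))
... | inj₂ e∈         = inj₂ e∈

Fits-right : ∀ {ds p l r} → Fits ds p (tri l r) → Fits ds (end p l) r
Fits-right {p = p} {l} fits c with fits (right c)
... | inj₁ (refl , _) = contradiction (p≤chord c) (<⇒≱ (p<end p l))
... | inj₂ e∈         = inj₂ e∈

module _ {ds : List Diag} (nc : NonCrossing (Joined ds))
         (ds-long : ∀ {x y} → (x , y) ∈ ds → suc (suc x) ≤ y) where

  -- The list `ds` belongs to the whole polygon and `t` may be a part of it. A diagonal from `p`
  -- that stays within `t` without being a chord of `t` would cross one; this chord does not start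
  -- at `p`, so it is not the root and lies in `ds`, which is non-crossing.
  nbrs≡neighbours : ∀ p t → Fits ds p t → nbrs ds p (end p t) ≡ neighbours p t
  nbrs≡neighbours p t fits =
    sorted-unique <-asym (<-irrefl refl) (nbrs-sorted ds p (end p t)) (neighbours-sorted p t) to from
    where
    to : ∀ {y} → y ∈ nbrs ds p (end p t) → y ∈ neighbours p t
    to y∈ with ∈-nbrs⁻ (<⇒≤ (p<end p t)) y∈
    ... | _ , _ , inj₁ refl                = suc∈neighbours p t
    ... | _ , _ , inj₂ (inj₁ refl)         = ∈-++⁺ʳ (rim p t) (here refl)
    ... | p<y , y≤q , inj₂ (inj₂ e∈) with chord-or-crosses t ≤-refl (ds-long e∈) y≤q
    ... | inj₁ c = Chord⇒neighbours p t c
    ... | inj₂ (_ , _ , c , cr) with fits c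
    ... | inj₂ f∈ = ⊥-elim (¬cross nc e∈ f∈ cr)
    ... | inj₁ (refl , refl) = case cr of λ where
      (inj₁ (p<p , _ , _)) → contradiction p<p (<-irrefl refl)
      (inj₂ (p<p , _ , _)) → contradiction p<p (<-irrefl refl)
    from : ∀ {y} → y ∈ neighbours p t → y ∈ nbrs ds p (end p t)
    from y∈ = let p<y , y≤q = neighbours-bounds p t y∈ in ∈-nbrs⁺ p<y y≤q
      ([ inj₁ , inj₂ ∘ Sum.map₁ proj₂ ∘ fits ]′ (∈-neighbours⁻ p t y∈))

  fansFuel≡fans : ∀ f p t → size t ≤ f → Fits ds p t → fansFuel f ds p (end p t) ≡ fans t
  -- Consecutive neighbours span the right children along the left spine, each smaller than `t` by
  -- at least one triangle; hence `suc f` here against `f` in the recursive calls. The parameter `g`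
  -- stands for the anonymous pattern-matching function inside `fansFuel`, known only through its
  -- values.
  laterFans≡ : ∀ f p t → size t ≤ suc f → Fits ds p t → (g : ℕ × ℕ → List ℕ) →
    (∀ u v → g (u , v) ≡ fansFuel f ds u v) →
    concatMap g (consecutive (neighbours p t)) ≡ laterFans t

  fansFuel≡fans zero    p edge      _    fits = refl
  fansFuel≡fans (suc f) p edge      _    fits = if-true (≤⇒≤ᵇ (≤-refl {suc p}))
  fansFuel≡fans (suc f) p t@(tri l r) size≤ fits = trans
    (if-false (λ q≤ → <⇒≱ (chord-long (root {p} {l} {r})) (≤ᵇ⇒≤ (end p t) (suc p) q≤)))
    (cong₂ _∷_
      (trans (cong (λ ns → length ns ∸ 1) (nbrs≡neighbours p t fits))
        (trans (cong (_∸ 1) (trans (length-++ (rim p t)) (+-comm _ 1))) (length-rim p t)))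
      (trans (cong (λ ns → concatMap _ (consecutive ns)) (nbrs≡neighbours p t fits))
        (laterFans≡ f p t size≤ fits _ (λ _ _ → refl))))

  laterFans≡ f p edge      size≤ fits g g≡ = refl
  laterFans≡ f p (tri l r) size≤ fits g g≡ = begin
    concatMap g (consecutive ((rim p l ++ m ∷ []) ++ q ∷ []))
      ≡⟨ cong (concatMap g ∘ consecutive) (++-assoc (rim p l) (m ∷ []) (q ∷ [])) ⟩
    concatMap g (consecutive (rim p l ++ m ∷ q ∷ []))
      ≡⟨ cong (concatMap g) (consecutive-∷ʳ (rim p l) m q) ⟩
    concatMap g (consecutive (neighbours p l) ++ (m , q) ∷ [])
      ≡⟨ concatMap-++ g (consecutive (neighbours p l)) ((m , q) ∷ []) ⟩
    concatMap g (consecutive (neighbours p l)) ++ (g (m , q) ++ [])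
      ≡⟨ cong₂ _++_
           (laterFans≡ f p l (≤-trans (m≤m+n (size l) (size r)) (≤-trans (n≤1+n _) size≤))
             (Fits-left fits) g g≡)
           (trans (++-identityʳ (g (m , q))) (trans (g≡ m q)
             (fansFuel≡fans f m r (≤-trans (m≤n+m (size r) (size l)) (≤-pred size≤))
               (Fits-right fits)))) ⟩
    laterFans l ++ fans r ∎
    where
    open ≡-Reasoning
    m = end p l
    q = end m r

fanSeq-diags : ∀ t → fanSeq (end 1 t) (diags t) ≡ fans t
fanSeq-diags t = fansFuel≡fans (Triangulation.nonCrossing Δ)
  (λ e∈ → proj₁ (proj₂ (Triangulation.valid Δ e∈)))
  (end 1 t) 1 t (≤-trans (m≤n+m (size t) 2) (≤-reflexive (sym (end≡ 1 t)))) fits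
  where
  Δ = diags-triangulation t
  fits : Fits (diags t) 1 t
  fits {x} {y} c with (x ≟ 1) ×-dec (y ≟ end 1 t)
  ... | yes eqs = inj₁ eqs
  ... | no ne   = inj₂ (∈-diags⁺ t c ne)

-- Statistics of fans against statistics of ascents

record FanStatistics (t s : ℕ) (ks : List ℕ) : Set where
  constructor mkFanStatistics
  field
    total       : length ks ≡ s + t
    singular    : countᵇ isSingletonᵇ ks ≡ s
    lastRegular : T (lastNotSingularᵇ ks)

-- A positive entry is 1 or long. Prescribing the total and the singular fans is therefore the same
-- as prescribing the long and the singleton ascents.
length-split : ∀ {ks} → All (1 ≤_) ks →
  length ks ≡ countᵇ isSingletonᵇ ks + countᵇ isLongᵇ ks
length-split []                           = refl
length-split {1 ∷ _}           (_ ∷ pos) = cong suc (length-split pos)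
length-split {suc (suc _) ∷ _} (_ ∷ pos) = trans (cong suc (length-split pos)) (sym (+-suc _ _))

lastNotSingularᵇ⇒anyLong : ∀ {k ks} → All (1 ≤_) (k ∷ ks) → T (lastNotSingularᵇ (k ∷ ks)) →
  T (any isLongᵇ (k ∷ ks))
lastNotSingularᵇ⇒anyLong {0} (() ∷ _) _
lastNotSingularᵇ⇒anyLong {suc (suc k)} {[]}    _         p = _
lastNotSingularᵇ⇒anyLong {suc (suc k)} {_ ∷ _} _         p = _
lastNotSingularᵇ⇒anyLong {1} {_ ∷ _} (_ ∷ pos) p = lastNotSingularᵇ⇒anyLong pos p

-- The last entry is positive and not 1, so it is long and comes after every singleton.
lastNotSingularᵇ⇒longLast : ∀ {ks} → All (1 ≤_) ks → T (lastNotSingularᵇ ks) →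
  T (noSingletonAfterLastLongᵇ ks)
lastNotSingularᵇ⇒longLast []                                  p = _
lastNotSingularᵇ⇒longLast {suc (suc k) ∷ []}    (_ ∷ pos) p = _
lastNotSingularᵇ⇒longLast {1 ∷ _ ∷ _}           (_ ∷ pos) p =
  ∧⁺ (lastNotSingularᵇ⇒anyLong pos p) (lastNotSingularᵇ⇒longLast pos p)
lastNotSingularᵇ⇒longLast {suc (suc k) ∷ _ ∷ _} (_ ∷ pos) p = lastNotSingularᵇ⇒longLast pos p

longLast⇒lastNotSingularᵇ : ∀ ks → T (noSingletonAfterLastLongᵇ ks) → T (lastNotSingularᵇ ks)
longLast⇒lastNotSingularᵇ []                   p = _
longLast⇒lastNotSingularᵇ (0 ∷ [])             p = _
longLast⇒lastNotSingularᵇ (suc (suc k) ∷ [])   p = _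
longLast⇒lastNotSingularᵇ (j ∷ k ∷ ks)         p =
  longLast⇒lastNotSingularᵇ (k ∷ ks)
    (proj₂ (∧⁻ {if isSingletonᵇ j then any isLongᵇ (k ∷ ks) else true} p))

Ascents⇒FanStatistics : ∀ {ℓ s ks} → All (1 ≤_) ks → Ascents ℓ s ks → FanStatistics ℓ s ks
Ascents⇒FanStatistics {ks = ks} pos (mkAscents refl refl last) =
  mkFanStatistics (length-split pos) refl (longLast⇒lastNotSingularᵇ ks last)

FanStatistics⇒Ascents : ∀ {ℓ s ks} → All (1 ≤_) ks → FanStatistics ℓ s ks → Ascents ℓ s ks
FanStatistics⇒Ascents {ks = ks} pos (mkFanStatistics total refl last) =
  mkAscents (+-cancelˡ-≡ (countᵇ isSingletonᵇ ks) _ _ (trans (sym (length-split pos)) total)) refl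
    (lastNotSingularᵇ⇒longLast pos last)

consPositive-positive : ∀ k {ks} → All (1 ≤_) ks → All (1 ≤_) (consPositive k ks)
consPositive-positive zero    pos = pos
consPositive-positive (suc k) pos = s≤s z≤n ∷ pos

laterFans-positive : ∀ t → All (1 ≤_) (laterFans t)
laterFans-positive edge      = []
laterFans-positive (tri l r) =
  All.++⁺ (laterFans-positive l) (consPositive-positive (spine r) (laterFans-positive r))

fans-positive : ∀ t → All (1 ≤_) (fans t)
fans-positive t = consPositive-positive (spine t) (laterFans-positive t)

-- The bijection between paths and triangulations

triᵇ : ℕ → ℕ → ℕ → List Diag → Bool
triᵇ n t s ds =
  isTriangulationᵇ n ds
  ∧ (length (fanSeq n ds) ≡ᵇ (s + t))
  ∧ (countᵇ isSingletonᵇ (fanSeq n ds) ≡ᵇ s)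
  ∧ lastNotSingularᵇ (fanSeq n ds)

triᵇ⁻ : ∀ n t s ds → T (triᵇ n t s ds) → Triangulation n ds × FanStatistics t s (fanSeq n ds)
triᵇ⁻ n t s ds p with ∧⁻ {isTriangulationᵇ n ds} p
... | Δ , p₁ with ∧⁻ {length (fanSeq n ds) ≡ᵇ (s + t)} p₁
... | total , p₂ with ∧⁻ {countᵇ isSingletonᵇ (fanSeq n ds) ≡ᵇ s} p₂
... | singular , last = isTriangulationᵇ⁻ n ds Δ ,
  mkFanStatistics (≡ᵇ⇒≡ (length (fanSeq n ds)) (s + t) total)
                  (≡ᵇ⇒≡ (countᵇ isSingletonᵇ (fanSeq n ds)) s singular) last

triᵇ⁺ : ∀ {n t s ds} → Triangulation n ds → FanStatistics t s (fanSeq n ds) → T (triᵇ n t s ds)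
triᵇ⁺ {n} {t} {s} {ds} Δ (mkFanStatistics total singular last) =
  ∧⁺ (isTriangulationᵇ⁺ Δ)
  (∧⁺ (≡⇒≡ᵇ (length (fanSeq n ds)) (s + t) total)
  (∧⁺ (≡⇒≡ᵇ (countᵇ isSingletonᵇ (fanSeq n ds)) s singular) last))

Dyck↔Tri : ∀ n ℓ s → Dyck n ℓ s ↔ Tri (suc (suc n)) ℓ s
Dyck↔Tri n ℓ s = relation-↔ {P = dyckᵇ n ℓ s} {Q = triᵇ (suc (suc n)) ℓ s} R toTri toDyck
  (λ { (t , _ , refl , refl) (t′ , _ , eq , refl) → cong diags (word-injective {t} {t′} eq) })
  (λ { (t , refl , refl , refl) (t′ , sz , refl , eq) →
    cong word (diags-injective {t} {t′}
      (trans (end≡ 1 t) (trans (cong (suc ∘ suc) (sym sz)) (sym (end≡ 1 t′)))) eq) })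
  where
  R : List Step → List Diag → Set
  R w ds = ∃ λ t → size t ≡ n × w ≡ word t × ds ≡ diags t

  ups : ∀ t → countᵇ isU (word t) ≡ size t
  ups t = trans (cong (countᵇ isU) (sym (++-identityʳ (word t))))
    (trans (countU-word t []) (+-identityʳ (size t)))

  toTri : ∀ w → T (dyckᵇ n ℓ s w) → ∃ λ ds → T (triᵇ (suc (suc n)) ℓ s ds) × R w ds
  toTri w p with dyckᵇ⁻ n ℓ s w p
  ... | refl , bal , asc with word-surjective bal
  ... | t , refl = diags t ,
    subst (λ n → T (triᵇ n ℓ s (diags t))) (trans (end≡ 1 t) (cong (suc ∘ suc) (sym (ups t))))
      (triᵇ⁺ (diags-triangulation t) (subst (FanStatistics ℓ s) (sym (fanSeq-diags t))
        (Ascents⇒FanStatistics (fans-positive t) (subst (Ascents ℓ s) (ascents-word t) asc)))) ,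
    t , sym (ups t) , refl , refl

  toDyck : ∀ ds → T (triᵇ (suc (suc n)) ℓ s ds) → ∃ λ w → T (dyckᵇ n ℓ s w) × R w ds
  toDyck ds p with triᵇ⁻ (suc (suc n)) ℓ s ds p
  ... | Δ , stats with chordTree Δ (s≤s (s≤s z≤n))
  ... | t , end≡n , refl = word t ,
    dyckᵇ⁺ (trans (ups t) size≡n)
      (subst (Balanced 0) (++-identityʳ (word t)) (word-balanced t stop))
      (subst (Ascents ℓ s) (sym (ascents-word t)) (FanStatistics⇒Ascents (fans-positive t)
        (subst (FanStatistics ℓ s) (fanSeq-diags t)
          (subst (λ n → FanStatistics ℓ s (fanSeq n (diags t))) (sym end≡n) stats)))) ,
    t , size≡n , refl , refl
    where
    size≡n : size t ≡ n
    size≡n = suc-injective (suc-injective (trans (sym (end≡ 1 t)) end≡n))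

-- Words in four letters

-- `two` and `low` share the constructor `leaf` because the path does not tell them apart: both are
-- a D directly after a D, and the Boolean comes from the queue.
data Letter : Set where
  top one : Letter
  leaf    : Bool → Letter

pattern two = leaf true
pattern low = leaf false

isTop isOne isTwo isLow : Letter → Bool
isTop top = true
isTop _   = false
isOne one = true
isOne _   = false
isTwo two = true
isTwo _   = false
isLow low = true
isLow _   = false

-- `c` is the number of ones still waiting for their two; ending at 0 makes the two counts equal.
Ballot : ℕ → List Letter → Set
Ballot c       []        = c ≡ 0
Ballot c       (top ∷ w) = Ballot c w
Ballot c       (one ∷ w) = Ballot (suc c) w
Ballot c       (low ∷ w) = Ballot c w
Ballot zero    (two ∷ w) = ⊥
Ballot (suc c) (two ∷ w) = Ballot c w

LowAfterTwo : List Letter → Set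
LowAfterTwo []        = ⊤
LowAfterTwo (top ∷ w) = LowAfterTwo w
LowAfterTwo (one ∷ w) = LowAfterTwo w
LowAfterTwo (two ∷ w) = ⊤
LowAfterTwo (low ∷ w) = ⊥

TopBeforeOne : List Letter → Set
TopBeforeOne []            = ⊤
TopBeforeOne (top ∷ w)     = T (any isOne w) × TopBeforeOne w
TopBeforeOne (one ∷ w)     = TopBeforeOne w
TopBeforeOne (leaf _ ∷ w)  = TopBeforeOne w

record Admissible (a i b : ℕ) (w : List Letter) : Set where
  constructor admissible
  field
    tops         : countᵇ isTop w ≡ b
    ones         : countᵇ isOne w ≡ i
    twos         : countᵇ isTwo w ≡ i
    lows         : countᵇ isLow w ≡ a
    ballot       : Ballot 0 w
    lowAfterTwo  : LowAfterTwo w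
    topBeforeOne : TopBeforeOne w

length-counts : ∀ w →
  length w ≡ countᵇ isTop w + (countᵇ isOne w + (countᵇ isTwo w + countᵇ isLow w))
length-counts []        = refl
length-counts (top ∷ w) = cong suc (length-counts w)
length-counts (one ∷ w) = trans (cong suc (length-counts w)) (sym (+-suc (countᵇ isTop w) _))
length-counts (two ∷ w) = trans (cong suc (length-counts w))
  (trans (sym (+-suc t _)) (cong (t +_) (sym (+-suc o _))))
  where t = countᵇ isTop w ; o = countᵇ isOne w
length-counts (low ∷ w) = trans (cong suc (length-counts w))
  (trans (sym (+-suc t _)) (cong (t +_)
    (trans (sym (+-suc o _)) (cong (o +_) (sym (+-suc s _))))))
  where t = countᵇ isTop w ; o = countᵇ isOne w ; s = countᵇ isTwo w

-- The degree sequence ds of a path lists the number of U's directly before each D.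
steps : List ℕ → List Step
steps []       = []
steps (d ∷ ds) = replicate d U ++ D ∷ steps ds

nonzero : List ℕ → List ℕ
nonzero []       = []
nonzero (d ∷ ds) = consPositive d (nonzero ds)

ascents-steps : ∀ ds → ascents (steps ds) ≡ nonzero ds
ascents-steps []       = refl
ascents-steps (d ∷ ds) = trans (run d 0) (cong₂ consPositive (+-identityʳ d) (ascents-steps ds))
  where
  run : ∀ d k → ascentsFrom k (replicate d U ++ D ∷ steps ds)
              ≡ consPositive (d + k) (ascents (steps ds))
  run zero    k = ascentsFrom-D k (steps ds)
  run (suc d) k = trans (ascentsFrom-U k _) (trans (run d (suc k))
    (cong (λ m → consPositive m (ascents (steps ds))) (+-suc d k)))

countD-steps : ∀ ds → countD (steps ds) ≡ length ds
countD-steps []           = refl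
countD-steps (zero ∷ ds)  = cong suc (countD-steps ds)
countD-steps (suc d ∷ ds) = countD-steps (d ∷ ds)

steps-surjective : ∀ {h w} → Balanced h w → ∃ λ ds → w ≡ steps ds
steps-surjective stop       = [] , refl
steps-surjective (down bal) with steps-surjective bal
... | ds , refl = 0 ∷ ds , refl
steps-surjective (up bal)   with steps-surjective bal
... | d ∷ ds , refl = suc d ∷ ds , refl
steps-surjective (up ()) | [] , refl

steps-injective : ∀ ds ds′ → steps ds ≡ steps ds′ → ds ≡ ds′
steps-injective []           []             eq = refl
steps-injective []           (zero ∷ ds′)   ()
steps-injective []           (suc d′ ∷ ds′) ()
steps-injective (zero ∷ ds)  []             ()
steps-injective (suc d ∷ ds) []             ()
steps-injective (zero ∷ ds)  (zero ∷ ds′)   eq = cong (0 ∷_) (steps-injective ds ds′ (∷-injectiveʳ eq))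
steps-injective (zero ∷ ds)  (suc d′ ∷ ds′) ()
steps-injective (suc d ∷ ds) (zero ∷ ds′)   ()
steps-injective (suc d ∷ ds) (suc d′ ∷ ds′) eq
  with steps-injective (d ∷ ds) (d′ ∷ ds′) (∷-injectiveʳ eq)
... | refl = refl

-- Enc q ds w: the queue q holds the labels (true for two, false for low) promised to the next leaves
-- of ds by the long ascents read so far.
data Enc : List Bool → List ℕ → List Letter → Set where
  done : Enc [] [] []
  sing : ∀ {q ds w} → Enc q ds w → Enc q (1 ∷ ds) (top ∷ w)
  long : ∀ {q ds w e} → Enc (q ++ true ∷ replicate e false) ds w →
         Enc q (suc (suc e) ∷ ds) (one ∷ w)
  pop  : ∀ {q ds w x} → Enc q ds w → Enc (x ∷ q) (0 ∷ ds) (leaf x ∷ w)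

length-push : ∀ q e → length (q ++ true ∷ replicate e false) ≡ suc (e + length q)
length-push q e = trans (length-++ q)
  (trans (+-suc _ _) (cong suc (trans (cong (length q +_) (length-replicate e)) (+-comm (length q) e))))

Balanced-run⁻ : ∀ d {h w} → Balanced h (replicate d U ++ w) → Balanced (d + h) w
Balanced-run⁻ zero            bal      = bal
Balanced-run⁻ (suc d) {h} {w} (up bal) =
  subst (λ k → Balanced k w) (+-suc d h) (Balanced-run⁻ d bal)

Balanced-run⁺ : ∀ d {h w} → Balanced (d + h) w → Balanced h (replicate d U ++ w)
Balanced-run⁺ zero            bal = bal
Balanced-run⁺ (suc d) {h} {w} bal =
  up (Balanced-run⁺ d (subst (λ k → Balanced k w) (sym (+-suc d h)) bal))

-- The length of the queue is the height of the path. An ascent of 2 + e U's with its D rises by 1 +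
-- e, the length of its block; a singleton with its D changes nothing, and a leaf removes one label.
-- So a leaf never meets an empty queue.
Enc-total : ∀ q ds → Balanced (length q) (steps ds) → ∃ (Enc q ds)
Enc-total []      []       stop            = [] , done
Enc-total (x ∷ q) (0 ∷ ds) (down bal)      =
  let w , enc = Enc-total q ds bal in leaf x ∷ w , pop enc
Enc-total q       (1 ∷ ds) (up (down bal)) =
  let w , enc = Enc-total q ds bal in top ∷ w , sing enc
Enc-total q       (suc (suc e) ∷ ds) bal with Balanced-run⁻ (suc (suc e)) bal
... | down bal′ =
  let w , enc = Enc-total _ ds (subst (λ h → Balanced h (steps ds)) (sym (length-push q e)) bal′)
  in one ∷ w , long enc

Enc⇒Balanced : ∀ {q ds w} → Enc q ds w → Balanced (length q) (steps ds)
Enc⇒Balanced done       = stop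
Enc⇒Balanced (sing enc) = up (down (Enc⇒Balanced enc))
Enc⇒Balanced (long {q} {ds} {e = e} enc) = Balanced-run⁺ (suc (suc e))
  (down (subst (λ h → Balanced h (steps ds)) (length-push q e) (Enc⇒Balanced enc)))
Enc⇒Balanced (pop enc)  = down (Enc⇒Balanced enc)

Enc-functional : ∀ {q ds w w′} → Enc q ds w → Enc q ds w′ → w ≡ w′
Enc-functional done       done        = refl
Enc-functional (sing enc) (sing enc′) = cong (top ∷_) (Enc-functional enc enc′)
Enc-functional (long enc) (long enc′) = cong (one ∷_) (Enc-functional enc enc′)
Enc-functional (pop enc)  (pop enc′)  = cong (_ ∷_) (Enc-functional enc enc′)

Enc-length : ∀ {q ds w} → Enc q ds w → length ds ≡ length w
Enc-length done       = refl
Enc-length (sing enc) = cong suc (Enc-length enc)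
Enc-length (long enc) = cong suc (Enc-length enc)
Enc-length (pop enc)  = cong suc (Enc-length enc)

Enc-singletons : ∀ {q ds w} → Enc q ds w → countᵇ isSingletonᵇ (nonzero ds) ≡ countᵇ isTop w
Enc-singletons done       = refl
Enc-singletons (sing enc) = cong suc (Enc-singletons enc)
Enc-singletons (long enc) = Enc-singletons enc
Enc-singletons (pop {x = true} enc)  = Enc-singletons enc
Enc-singletons (pop {x = false} enc) = Enc-singletons enc

Enc-longs : ∀ {q ds w} → Enc q ds w → countᵇ isLongᵇ (nonzero ds) ≡ countᵇ isOne w
Enc-longs done       = refl
Enc-longs (sing enc) = Enc-longs enc
Enc-longs (long enc) = cong suc (Enc-longs enc)
Enc-longs (pop {x = true} enc)  = Enc-longs enc
Enc-longs (pop {x = false} enc) = Enc-longs enc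

Enc-anyLong : ∀ {q ds w} → Enc q ds w → any isLongᵇ (nonzero ds) ≡ any isOne w
Enc-anyLong done       = refl
Enc-anyLong (sing enc) = Enc-anyLong enc
Enc-anyLong (long enc) = refl
Enc-anyLong (pop enc)  = Enc-anyLong enc

Enc-topBeforeOne⁺ : ∀ {q ds w} → Enc q ds w →
  T (noSingletonAfterLastLongᵇ (nonzero ds)) → TopBeforeOne w
Enc-topBeforeOne⁺ done       p = _
Enc-topBeforeOne⁺ (sing enc) p =
  let any , p′ = ∧⁻ p in subst T (Enc-anyLong enc) any , Enc-topBeforeOne⁺ enc p′
Enc-topBeforeOne⁺ (long enc) p = Enc-topBeforeOne⁺ enc p
Enc-topBeforeOne⁺ (pop enc)  p = Enc-topBeforeOne⁺ enc p

Enc-topBeforeOne⁻ : ∀ {q ds w} → Enc q ds w →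
  TopBeforeOne w → T (noSingletonAfterLastLongᵇ (nonzero ds))
Enc-topBeforeOne⁻ done       p = _
Enc-topBeforeOne⁻ (sing enc) (any , p) =
  ∧⁺ (subst T (sym (Enc-anyLong enc)) any) (Enc-topBeforeOne⁻ enc p)
Enc-topBeforeOne⁻ (long enc) p = Enc-topBeforeOne⁻ enc p
Enc-topBeforeOne⁻ (pop enc)  p = Enc-topBeforeOne⁻ enc p

countTrue-push : ∀ q e → countᵇ id (q ++ true ∷ replicate e false) ≡ suc (countᵇ id q)
countTrue-push []          zero    = refl
countTrue-push []          (suc e) = countTrue-push [] e
countTrue-push (true ∷ q)  e       = cong suc (countTrue-push q e)
countTrue-push (false ∷ q) e       = countTrue-push q e

-- Each block contains `true` exactly once, so the trues in the queue count the ones still waiting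
-- for their two.
Enc-ballot : ∀ {q ds w} → Enc q ds w → Ballot (countᵇ id q) w
Enc-ballot done       = refl
Enc-ballot (sing enc) = Enc-ballot enc
Enc-ballot (long {q} {w = w} {e = e} enc) =
  subst (λ c → Ballot c w) (countTrue-push q e) (Enc-ballot enc)
Enc-ballot (pop {x = true} enc)  = Enc-ballot enc
Enc-ballot (pop {q} {x = false} enc) = Enc-ballot enc

Ballot-balanced : ∀ c w → Ballot c w → c + countᵇ isOne w ≡ countᵇ isTwo w
Ballot-balanced c       []        bal = trans (+-identityʳ c) bal
Ballot-balanced c       (top ∷ w) bal = Ballot-balanced c w bal
Ballot-balanced c       (one ∷ w) bal = trans (+-suc c _) (Ballot-balanced (suc c) w bal)
Ballot-balanced (suc c) (two ∷ w) bal = cong suc (Ballot-balanced c w bal)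
Ballot-balanced c       (low ∷ w) bal = Ballot-balanced c w bal

-- The state of the queue until the first leaf, when blocks have only been appended. Later a false
-- may come to the front, but then a two has been read and `LowAfterTwo` is settled.
data TwoFirst : List Bool → Set where
  empty : TwoFirst []
  two∷  : ∀ {q} → TwoFirst (true ∷ q)

TwoFirst-++ : ∀ {q l} → TwoFirst q → TwoFirst (q ++ true ∷ l)
TwoFirst-++ empty = two∷
TwoFirst-++ two∷  = two∷

Enc-lowAfterTwo : ∀ {q ds w} → TwoFirst q → Enc q ds w → LowAfterTwo w
Enc-lowAfterTwo empty done       = _
Enc-lowAfterTwo tf    (sing enc) = Enc-lowAfterTwo tf enc
Enc-lowAfterTwo tf    (long enc) = Enc-lowAfterTwo (TwoFirst-++ tf) enc
Enc-lowAfterTwo two∷  (pop enc)  = _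

-- Recovering the path from the word

leaves : List Letter → List Bool
leaves []           = []
leaves (top ∷ w)    = leaves w
leaves (one ∷ w)    = leaves w
leaves (leaf x ∷ w) = x ∷ leaves w

blocks : List ℕ → List Bool
blocks []       = []
blocks (e ∷ es) = true ∷ replicate e false ++ blocks es

-- The first component counts the falses ahead of the first true; a true put in front turns them
-- into a block.
unblocks : List Bool → ℕ × List ℕ
unblocks []          = 0 , []
unblocks (true ∷ l)  = let e , es = unblocks l in 0 , e ∷ es
unblocks (false ∷ l) = let e , es = unblocks l in suc e , es

unblocks-blocks : ∀ e es → unblocks (replicate e false ++ blocks es) ≡ (e , es)
unblocks-blocks zero    []       = refl
unblocks-blocks zero    (e ∷ es) rewrite unblocks-blocks e es = refl
unblocks-blocks (suc e) es       rewrite unblocks-blocks e es = refl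

blocks-unblocks : ∀ l → let e , es = unblocks l in l ≡ replicate e false ++ blocks es
blocks-unblocks []          = refl
blocks-unblocks (true ∷ l)  = cong (true ∷_) (blocks-unblocks l)
blocks-unblocks (false ∷ l) = cong (false ∷_) (blocks-unblocks l)

blocks-injective : ∀ {es es′} → blocks es ≡ blocks es′ → es ≡ es′
blocks-injective {es} {es′} eq =
  cong proj₂ (trans (sym (unblocks-blocks 0 es)) (trans (cong unblocks eq) (unblocks-blocks 0 es′)))

countTwo-leaves : ∀ w → countᵇ id (leaves w) ≡ countᵇ isTwo w
countTwo-leaves []        = refl
countTwo-leaves (top ∷ w) = countTwo-leaves w
countTwo-leaves (one ∷ w) = countTwo-leaves w
countTwo-leaves (two ∷ w) = cong suc (countTwo-leaves w)
countTwo-leaves (low ∷ w) = countTwo-leaves w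

leaves-twoFirst : ∀ w → LowAfterTwo w → TwoFirst (leaves w)
leaves-twoFirst []        p = empty
leaves-twoFirst (top ∷ w) p = leaves-twoFirst w p
leaves-twoFirst (one ∷ w) p = leaves-twoFirst w p
leaves-twoFirst (two ∷ w) p = two∷

countTrue-blocks : ∀ e es → countᵇ id (replicate e false ++ blocks es) ≡ length es
countTrue-blocks zero    []       = refl
countTrue-blocks zero    (e ∷ es) = cong suc (countTrue-blocks e es)
countTrue-blocks (suc e) es       = countTrue-blocks e es

twoFirst⇒blocks : ∀ {l} → TwoFirst l → ∃ λ es → l ≡ blocks es
twoFirst⇒blocks empty            = [] , refl
twoFirst⇒blocks (two∷ {l}) = let e , es = unblocks l in e ∷ es , cong (true ∷_) (blocks-unblocks l)

-- The list `es` holds the excesses of the long ascents still to come, read off in advance from the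
-- labels of all leaves; the equation on lengths gives every `one` its excess. For a `two` at an
-- empty queue the ballot hypothesis is absurd.
assemble : ∀ w q es → leaves w ≡ q ++ blocks es → Ballot (countᵇ id q) w →
  length es ≡ countᵇ isOne w → ∃ λ ds → Enc q ds w
assemble []           []      es       eq bal len = [] , done
assemble (top ∷ w)    q       es       eq bal len =
  let ds , enc = assemble w q es eq bal len in 1 ∷ ds , sing enc
assemble (one ∷ w)    q       (e ∷ es) eq bal len =
  let ds , enc = assemble w (q ++ true ∷ replicate e false) es
        (trans eq (sym (++-assoc q (true ∷ replicate e false) (blocks es))))
        (subst (λ c → Ballot c w) (sym (countTrue-push q e)) bal) (suc-injective len)
  in suc (suc e) ∷ ds , long enc
assemble (two ∷ w)    (true ∷ q) es eq bal len =
  let ds , enc = assemble w q es (∷-injectiveʳ eq) bal len in 0 ∷ ds , pop enc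
assemble (low ∷ w)    (false ∷ q) es eq bal len =
  let ds , enc = assemble w q es (∷-injectiveʳ eq) bal len in 0 ∷ ds , pop enc
-- At an empty queue the next label opens a block, so it cannot be a low.
assemble (low ∷ w)    []      (e ∷ es) () bal len

Admissible⇒Enc : ∀ {a i b w} → Admissible a i b w → ∃ λ ds → Enc [] ds w
Admissible⇒Enc {w = w} (admissible _ ones twos _ ballot lat _) =
  let es , eq = twoFirst⇒blocks (leaves-twoFirst w lat)
  in assemble w [] es eq ballot
       (trans (sym (countTrue-blocks 0 es)) (trans (sym (cong (countᵇ id) eq))
         (trans (countTwo-leaves w) (trans twos (sym ones)))))

excesses : List ℕ → List ℕ
excesses []                 = []
excesses (0 ∷ ds)           = excesses ds
excesses (1 ∷ ds)           = excesses ds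
excesses (suc (suc e) ∷ ds) = e ∷ excesses ds

fill : List ℕ → List Letter → List ℕ
fill es       []           = []
fill es       (top ∷ w)    = 1 ∷ fill es w
-- A default value, not reached when the excesses are those of a path encoded by the word.
fill []       (one ∷ w)    = []
fill (e ∷ es) (one ∷ w)    = suc (suc e) ∷ fill es w
fill es       (leaf _ ∷ w) = 0 ∷ fill es w

Enc-fill : ∀ {q ds w} → Enc q ds w → ds ≡ fill (excesses ds) w
Enc-fill done       = refl
Enc-fill (sing enc) = cong (1 ∷_) (Enc-fill enc)
Enc-fill (long enc) = cong (_ ∷_) (Enc-fill enc)
Enc-fill (pop enc)  = cong (0 ∷_) (Enc-fill enc)

Enc-leaves : ∀ {q ds w} → Enc q ds w → leaves w ≡ q ++ blocks (excesses ds)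
Enc-leaves done       = refl
Enc-leaves (sing enc) = Enc-leaves enc
Enc-leaves (long {q} {ds} {e = e} enc) =
  trans (Enc-leaves enc) (++-assoc q (true ∷ replicate e false) (blocks (excesses ds)))
Enc-leaves (pop enc)  = cong (_ ∷_) (Enc-leaves enc)

-- The word fixes every degree except those of its ones. These are fixed by the excesses, which the
-- sequence of leaf labels determines because its splitting into blocks is unique.
Enc-injective : ∀ {q ds ds′ w} → Enc q ds w → Enc q ds′ w → ds ≡ ds′
Enc-injective {q} {w = w} enc enc′ =
  trans (Enc-fill enc) (trans (cong (λ es → fill es w) es≡) (sym (Enc-fill enc′)))
  where
  es≡ = blocks-injective (++-cancelˡ q _ _ (trans (sym (Enc-leaves enc)) (Enc-leaves enc′)))

-- The correspondence between words and paths

Codes : List Letter → List Step → Set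
Codes w p = ∃ λ ds → Enc [] ds w × p ≡ steps ds

-- Here `a` and `b` are the parameters of the theorem less 2. The left side is the semi-length, the
-- right side the number of letters top, one, two and low.
size≡ : ∀ a i b → a + suc (suc b) + 2 * i ≡ b + (suc i + (suc i + a))
size≡ = solve 3 (λ a i b →
  a :+ (con 2 :+ b) :+ con 2 :* i := b :+ (con 1 :+ i :+ (con 1 :+ i :+ a))) refl
  where open +-*-Solver

Admissible⇒Dyck : ∀ {a i b w} → Admissible a (suc i) b w →
  ∃ λ p → T (dyckᵇ (a + suc (suc b) + 2 * i) (suc i) b p) × Codes w p
Admissible⇒Dyck {a} {i} {b} {w} adm@(admissible tops ones twos lows bal lat tbo) with Admissible⇒Enc adm
... | ds , enc = steps ds ,
  dyckᵇ⁺ ups balanced (subst (Ascents (suc i) b) (sym (ascents-steps ds))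
    (mkAscents (trans (Enc-longs enc) ones) (trans (Enc-singletons enc) tops)
               (Enc-topBeforeOne⁻ enc tbo))) ,
  ds , enc , refl
  where
  balanced = Enc⇒Balanced enc
  ups : countᵇ isU (steps ds) ≡ a + suc (suc b) + 2 * i
  ups = begin
    countᵇ isU (steps ds)           ≡⟨ Balanced-count balanced ⟩
    countD (steps ds)               ≡⟨ countD-steps ds ⟩
    length ds                       ≡⟨ Enc-length enc ⟩
    length w                        ≡⟨ length-counts w ⟩
    countᵇ isTop w + (countᵇ isOne w + (countᵇ isTwo w + countᵇ isLow w))
      ≡⟨ cong₂ _+_ tops (cong₂ _+_ ones (cong₂ _+_ twos lows)) ⟩
    b + (suc i + (suc i + a))       ≡⟨ size≡ a i b ⟨
    a + suc (suc b) + 2 * i         ∎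
    where open ≡-Reasoning

Dyck⇒Admissible : ∀ a i b p → T (dyckᵇ (a + suc (suc b) + 2 * i) (suc i) b p) →
  ∃ λ w → Admissible a (suc i) b w × Codes w p
Dyck⇒Admissible a i b p valid with dyckᵇ⁻ (a + suc (suc b) + 2 * i) (suc i) b p valid
... | ups , bal , asc with steps-surjective bal
... | ds , refl with Enc-total [] ds bal | subst (Ascents (suc i) b) (ascents-steps ds) asc
... | w , enc | mkAscents longs singles nosing = w , adm , ds , enc , refl
  where
  tops = trans (sym (Enc-singletons enc)) singles
  ones = trans (sym (Enc-longs enc)) longs
  ballot = Enc-ballot enc
  twos = trans (sym (Ballot-balanced 0 w ballot)) ones
  -- No statistic of the path counts the lows. Ascents give the tops and ones, the ballot condition
  -- gives the twos, and cancelling these from the semi-length leaves the lows.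
  total : b + (suc i + (suc i + countᵇ isLow w)) ≡ b + (suc i + (suc i + a))
  total = begin
    b + (suc i + (suc i + countᵇ isLow w))
      ≡⟨ cong₂ _+_ tops (cong₂ _+_ ones (cong (_+ countᵇ isLow w) twos)) ⟨
    countᵇ isTop w + (countᵇ isOne w + (countᵇ isTwo w + countᵇ isLow w)) ≡⟨ length-counts w ⟨
    length w                        ≡⟨ Enc-length enc ⟨
    length ds                       ≡⟨ countD-steps ds ⟨
    countD (steps ds)               ≡⟨ Balanced-count bal ⟨
    countᵇ isU (steps ds)           ≡⟨ ups ⟩
    a + suc (suc b) + 2 * i         ≡⟨ size≡ a i b ⟩
    b + (suc i + (suc i + a))       ∎
    where open ≡-Reasoning
  adm : Admissible a (suc i) b w
  adm = admissible tops ones twos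
    (+-cancelˡ-≡ (suc i) _ _ (+-cancelˡ-≡ (suc i) _ _ (+-cancelˡ-≡ b _ _ total)))
    ballot (Enc-lowAfterTwo empty enc) (Enc-topBeforeOne⁺ enc nosing)

Codes-functional : ∀ {w p p′} → Codes w p → Codes w p′ → p ≡ p′
Codes-functional (ds , enc , refl) (ds′ , enc′ , refl) = cong steps (Enc-injective enc enc′)

Codes-injective : ∀ {w w′ p} → Codes w p → Codes w′ p → w ≡ w′
Codes-injective (ds , enc , refl) (ds′ , enc′ , eq) with steps-injective ds ds′ eq
... | refl = Enc-functional enc enc′

-- Positions of letters

is : Letter → Letter → Bool
is top = isTop
is one = isOne
is two = isTwo
is low = isLow

is-refl : ∀ x → T (is x x)
is-refl top = _
is-refl one = _
is-refl two = _
is-refl low = _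

is⇒≡ : ∀ x y → T (is x y) → y ≡ x
is⇒≡ top top _ = refl
is⇒≡ one one _ = refl
is⇒≡ two two _ = refl
is⇒≡ low low _ = refl

positions : (Letter → Bool) → ℕ → List Letter → List ℕ
positions f k []      = []
positions f k (x ∷ w) = if f x then k ∷ positions f (suc k) w else positions f (suc k) w

∈-positions-bounds : ∀ f k w {y} → y ∈ positions f k w → k ≤ y × y < k + length w
∈-positions-bounds f k (x ∷ w) {y} y∈ = split (f x) y∈
  where
  later : y ∈ positions f (suc k) w → k ≤ y × y < k + suc (length w)
  later y∈ = let k<y , y< = ∈-positions-bounds f (suc k) w y∈ in
    <⇒≤ k<y , subst (y <_) (sym (+-suc k _)) y<
  split : ∀ b → y ∈ (if b then k ∷ positions f (suc k) w else positions f (suc k) w) →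
    k ≤ y × y < k + suc (length w)
  split true  (here refl) = ≤-refl , m<m+n k (s≤s z≤n)
  split true  (there y∈)  = later y∈
  split false y∈          = later y∈

positions-after : ∀ f k w → All (k <_) (positions f (suc k) w)
positions-after f k w = All.tabulate (proj₁ ∘ ∈-positions-bounds f (suc k) w)

positions-increasing : ∀ f k w → AllPairs _<_ (positions f k w)
positions-increasing f k []      = []
positions-increasing f k (x ∷ w) with f x
... | true  = positions-after f k w ∷ positions-increasing f (suc k) w
... | false = positions-increasing f (suc k) w

length-positions : ∀ f k w → length (positions f k w) ≡ countᵇ f w
length-positions f k []      = refl
length-positions f k (x ∷ w) with f x
... | true  = cong suc (length-positions f (suc k) w)
... | false = length-positions f (suc k) w

positions-disjoint : ∀ {f g} → (∀ x → T (f x) → ¬ T (g x)) →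
  ∀ k w {y} → y ∈ positions f k w → y ∉ positions g k w
positions-disjoint {f} {g} dis k (x ∷ w) y∈f y∈g with f x | g x | dis x
... | true  | true  | d = d _ _
... | false | false | _ = positions-disjoint dis (suc k) w y∈f y∈g
positions-disjoint {f} {g} dis k (x ∷ w) (here refl) y∈g | true | false | _ =
  <-irrefl refl (All.lookup (positions-after g k w) y∈g)
positions-disjoint {f} {g} dis k (x ∷ w) (there y∈f) y∈g | true | false | _ =
  positions-disjoint dis (suc k) w y∈f y∈g
positions-disjoint {f} {g} dis k (x ∷ w) y∈f (here refl) | false | true | _ =
  <-irrefl refl (All.lookup (positions-after f k w) y∈f)
positions-disjoint {f} {g} dis k (x ∷ w) y∈f (there y∈g) | false | true | _ =
  positions-disjoint dis (suc k) w y∈f y∈g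

positions-head : ∀ x k w → k ∈ positions (is x) k (x ∷ w)
positions-head x k w with is x x | is-refl x
... | true | _ = here refl

positions-head⁻ : ∀ x k y w → k ∈ positions (is x) k (y ∷ w) → y ≡ x
positions-head⁻ x k y w k∈ with is x y | is⇒≡ x y
... | true  | eq = eq _
... | false | _  = contradiction (All.lookup (positions-after (is x) k w) k∈) (<-irrefl refl)

-- The position `k` occurs only in the list of the first letter, which is thereby determined.
positions-injective : ∀ k w w′ → (∀ x → positions (is x) k w ≡ positions (is x) k w′) → w ≡ w′
positions-injective k []      []       eq = refl
positions-injective k []      (y ∷ w′) eq with () ← subst (k ∈_) (sym (eq y)) (positions-head y k w′)
positions-injective k (x ∷ w) []       eq with () ← subst (k ∈_) (eq x) (positions-head x k w)
positions-injective k (x ∷ w) (y ∷ w′) eq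
  with refl ← positions-head⁻ x k y w′ (subst (k ∈_) (eq x) (positions-head x k w)) =
  cong (x ∷_) (positions-injective (suc k) w w′ λ z → tail (is z x) (eq z))
  where
  tail : ∀ b {zs zs′} → (if b then k ∷ zs else zs) ≡ (if b then k ∷ zs′ else zs′) → zs ≡ zs′
  tail true  eq = ∷-injectiveʳ eq
  tail false eq = eq

range : ℕ → ℕ → List ℕ
range k zero    = []
range k (suc n) = k ∷ range (suc k) n

∈-range : ∀ {k n y} → k ≤ y → y < k + n → y ∈ range k n
∈-range {k} {zero}  {y} k≤y y< = contradiction k≤y (<⇒≱ (subst (y <_) (+-identityʳ k) y<))
∈-range {k} {suc n} {y} k≤y y< with m≤n⇒m<n∨m≡n k≤y
... | inj₁ k<y  = there (∈-range k<y (subst (y <_) (+-suc k n) y<))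
... | inj₂ refl = here refl

length-range : ∀ k n → length (range k n) ≡ n
length-range k zero    = refl
length-range k (suc n) = cong suc (length-range (suc k) n)

positions-map⁺ : ∀ f (cls : ℕ → Letter) k n {y} → y ∈ range k n → T (f (cls y)) →
  y ∈ positions f k (map cls (range k n))
positions-map⁺ f cls k (suc n) y∈ fy with f (cls k) in eq
positions-map⁺ f cls k (suc n) (here refl) fy | true  = here refl
positions-map⁺ f cls k (suc n) (here refl) fy | false = ⊥-elim (subst T eq fy)
positions-map⁺ f cls k (suc n) (there y∈)  fy | true  = there (positions-map⁺ f cls (suc k) n y∈ fy)
positions-map⁺ f cls k (suc n) (there y∈)  fy | false = positions-map⁺ f cls (suc k) n y∈ fy

positions-map⁻ : ∀ f (cls : ℕ → Letter) k n {y} → y ∈ positions f k (map cls (range k n)) →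
  y ∈ range k n × T (f (cls y))
positions-map⁻ f cls k (suc n) y∈ with f (cls k) in eq
positions-map⁻ f cls k (suc n) (here refl) | true = here refl , subst T (sym eq) _
positions-map⁻ f cls k (suc n) (there y∈)  | true =
  let y∈r , fy = positions-map⁻ f cls (suc k) n y∈ in there y∈r , fy
positions-map⁻ f cls k (suc n) y∈          | false =
  let y∈r , fy = positions-map⁻ f cls (suc k) n y∈ in there y∈r , fy

-- Pigeonhole for distinct entries

Unique-⊆-length : {A : Set} {xs ys : List A} → AllPairs _≢_ xs → (∀ {z} → z ∈ xs → z ∈ ys) →
  length xs ≤ length ys
Unique-⊆-length []           sub = z≤n
Unique-⊆-length {A} {x ∷ xs} (x∉xs ∷ uniq) sub with ∈-∃++ (sub (here refl))
... | as , bs , refl = ≤-trans (s≤s (Unique-⊆-length uniq sub′)) (≤-reflexive len)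
  where
  len : suc (length (as ++ bs)) ≡ length (as ++ x ∷ bs)
  len = trans (cong suc (length-++ as)) (trans (sym (+-suc _ _)) (sym (length-++ as)))
  sub′ : ∀ {z} → z ∈ xs → z ∈ as ++ bs
  sub′ z∈ with ∈-++⁻ as (sub (there z∈))
  ... | inj₁ z∈as         = ∈-++⁺ˡ z∈as
  ... | inj₂ (here refl)  = contradiction refl (All.lookup x∉xs z∈)
  ... | inj₂ (there z∈bs) = ∈-++⁺ʳ as z∈bs

-- A missing value could be added to the list, making one more distinct value than the range has
-- room for. The test on tableaux checks only bounds and distinctness, and this recovers that each
-- of 1, ..., N is used.
Unique-covers : ∀ {xs} → AllPairs _≢_ xs → All (λ x → 1 ≤ x × x ≤ length xs) xs →
  ∀ {y} → 1 ≤ y → y ≤ length xs → y ∈ xs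
Unique-covers {xs} uniq bounds {y} 1≤y y≤n with _∈?_ _≟_ y xs
... | yes y∈ = y∈
... | no  y∉ = contradiction
  (Unique-⊆-length (All.tabulate (λ z∈ y≡z → y∉ (subst (_∈ xs) (sym y≡z) z∈)) ∷ uniq) inRange)
  (<⇒≱ (≤-reflexive (cong suc (length-range 1 (length xs)))))
  where
  inRange : ∀ {z} → z ∈ y ∷ xs → z ∈ range 1 (length xs)
  inRange (here refl) = ∈-range 1≤y (s≤s y≤n)
  inRange (there z∈)  = let 1≤z , z≤len = All.lookup bounds z∈ in ∈-range 1≤z (s≤s z≤len)

Unique-++-disjoint : {A : Set} (xs : List A) {ys : List A} → AllPairs _≢_ (xs ++ ys) →
  ∀ {z} → z ∈ xs → z ∉ ys
Unique-++-disjoint (x ∷ xs) (x∉ ∷ _)    (here refl) z∈ys = All.lookup x∉ (∈-++⁺ʳ xs z∈ys) refl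
Unique-++-disjoint (x ∷ xs) (_ ∷ uniq)  (there z∈)  z∈ys = Unique-++-disjoint xs uniq z∈ z∈ys

Unique-++ʳ : {A : Set} (xs : List A) {ys : List A} → AllPairs _≢_ (xs ++ ys) → AllPairs _≢_ ys
Unique-++ʳ []       uniq       = uniq
Unique-++ʳ (x ∷ xs) (_ ∷ uniq) = Unique-++ʳ xs uniq

-- Fillings

-- Since the long rows increase, being less than some entry of the upper one means being less than
-- its last entry, in the last column; exceeding some entry of the lower one means exceeding its
-- first, in the first column. This form mentions no indices. As in `size≡`, `a` and `b` are already
-- lowered by 2.
record Filling (a i b : ℕ) (L : Letter → List ℕ) : Set where
  field
    lengthTop  : length (L top) ≡ b
    lengthOne  : length (L one) ≡ suc i
    lengthTwo  : length (L two) ≡ suc i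
    lengthLow  : length (L low) ≡ a
    increasing : ∀ x → AllPairs _<_ (L x)
    top<one    : All (λ y → Any (y <_) (L one)) (L top)
    one<two    : Pointwise _<_ (L one) (L two)
    two<low    : All (λ y → Any (_< y) (L two)) (L low)
  entries : List ℕ
  entries = L top ++ L one ++ L two ++ L low
  field
    bounds : All (λ x → 1 ≤ x × x ≤ length entries) entries
    unique : AllPairs _≢_ entries

place : List Letter → Letter → List ℕ
place w x = positions (is x) 1 w

topBeforeOne⁺ : ∀ k w → TopBeforeOne w →
  All (λ y → Any (y <_) (positions isOne k w)) (positions isTop k w)
topBeforeOne⁺ k []           p       = []
topBeforeOne⁺ k (top ∷ w)    (o , p) = exists (suc k) w ≤-refl o ∷ topBeforeOne⁺ (suc k) w p
  where
  exists : ∀ j w → k < j → T (any isOne w) → Any (k <_) (positions isOne j w)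
  exists j (top ∷ w)    k<j o = exists (suc j) w (m≤n⇒m≤1+n k<j) o
  exists j (one ∷ w)    k<j o = here k<j
  exists j (leaf _ ∷ w) k<j o = exists (suc j) w (m≤n⇒m≤1+n k<j) o
topBeforeOne⁺ k (one ∷ w)    p       = All.map there (topBeforeOne⁺ (suc k) w p)
topBeforeOne⁺ k (leaf _ ∷ w) p       = topBeforeOne⁺ (suc k) w p

topBeforeOne⁻ : ∀ k w → All (λ y → Any (y <_) (positions isOne k w)) (positions isTop k w) →
  TopBeforeOne w
topBeforeOne⁻ k []           ps       = _
topBeforeOne⁻ k (top ∷ w)    (p ∷ ps) = exists (suc k) w p , topBeforeOne⁻ (suc k) w ps
  where
  exists : ∀ j w → Any (k <_) (positions isOne j w) → T (any isOne w)
  exists j (top ∷ w)    p = exists (suc j) w p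
  exists j (one ∷ w)    p = _
  exists j (leaf _ ∷ w) p = exists (suc j) w p
topBeforeOne⁻ k (one ∷ w)    ps       = topBeforeOne⁻ (suc k) w (All.tabulate λ y∈ →
  case All.lookup ps y∈ of λ where
    (here y<k) → contradiction y<k (<-asym (All.lookup (positions-after isTop k w) y∈))
    (there p)  → p)
topBeforeOne⁻ k (leaf _ ∷ w) ps       = topBeforeOne⁻ (suc k) w ps

lowAfterTwo⁺ : ∀ k w → LowAfterTwo w →
  All (λ y → Any (_< y) (positions isTwo k w)) (positions isLow k w)
lowAfterTwo⁺ k []        p = []
lowAfterTwo⁺ k (top ∷ w) p = lowAfterTwo⁺ (suc k) w p
lowAfterTwo⁺ k (one ∷ w) p = lowAfterTwo⁺ (suc k) w p
lowAfterTwo⁺ k (two ∷ w) p = All.map here (positions-after isLow k w)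

lowAfterTwo⁻ : ∀ k w → All (λ y → Any (_< y) (positions isTwo k w)) (positions isLow k w) →
  LowAfterTwo w
lowAfterTwo⁻ k []        ps      = _
lowAfterTwo⁻ k (top ∷ w) ps      = lowAfterTwo⁻ (suc k) w ps
lowAfterTwo⁻ k (one ∷ w) ps      = lowAfterTwo⁻ (suc k) w ps
lowAfterTwo⁻ k (two ∷ w) ps      = _
lowAfterTwo⁻ k (low ∷ w) (p ∷ _) =
  let y , y∈ , y<k = find p in <-asym y<k (All.lookup (positions-after isTwo k w) y∈)

-- P holds the positions of the letters one that still wait for their two.
ballot⁺ : ∀ k w P → All (_< k) P → Ballot (length P) w →
  Pointwise _<_ (P ++ positions isOne k w) (positions isTwo k w)
ballot⁺ k []        []      _         bal = []
ballot⁺ k (top ∷ w) P       P<k       bal = ballot⁺ (suc k) w P (All.map m≤n⇒m≤1+n P<k) bal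
ballot⁺ k (low ∷ w) P       P<k       bal = ballot⁺ (suc k) w P (All.map m≤n⇒m≤1+n P<k) bal
ballot⁺ k (two ∷ w) (z ∷ P) (z<k ∷ P<k) bal = z<k ∷ ballot⁺ (suc k) w P (All.map m≤n⇒m≤1+n P<k) bal
ballot⁺ k (one ∷ w) P       P<k       bal =
  subst (λ zs → Pointwise _<_ zs (positions isTwo (suc k) w)) (++-assoc P [ k ] _)
    (ballot⁺ (suc k) w (P ++ [ k ]) (All.++⁺ (All.map m≤n⇒m≤1+n P<k) (≤-refl ∷ []))
      (subst (λ c → Ballot c w) (sym (trans (length-++ P) (+-comm _ 1))) bal))

ballot⁻ : ∀ k w P → All (_< k) P →
  Pointwise _<_ (P ++ positions isOne k w) (positions isTwo k w) → Ballot (length P) w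
ballot⁻ k []        []      _         ps = refl
ballot⁻ k (top ∷ w) P       P<k       ps = ballot⁻ (suc k) w P (All.map m≤n⇒m≤1+n P<k) ps
ballot⁻ k (low ∷ w) P       P<k       ps = ballot⁻ (suc k) w P (All.map m≤n⇒m≤1+n P<k) ps
ballot⁻ k (two ∷ w) (z ∷ P) (z<k ∷ P<k) (_ ∷ ps) = ballot⁻ (suc k) w P (All.map m≤n⇒m≤1+n P<k) ps
-- With no one waiting, this two would be paired with a one at a later position.
ballot⁻ k (two ∷ w) []      _         ps with positions isOne (suc k) w | positions-after isOne k w
ballot⁻ k (two ∷ w) []      _         (x<k ∷ ps) | x ∷ _ | k<x ∷ _ = <-asym x<k k<x
ballot⁻ k (one ∷ w) P       P<k       ps =
  subst (λ c → Ballot c w) (trans (length-++ P) (+-comm _ 1))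
    (ballot⁻ (suc k) w (P ++ [ k ]) (All.++⁺ (All.map m≤n⇒m≤1+n P<k) (≤-refl ∷ []))
      (subst (λ zs → Pointwise _<_ zs (positions isTwo (suc k) w)) (sym (++-assoc P [ k ] _)) ps))

Admissible⇒Filling : ∀ {a i b w} → Admissible a (suc i) b w → Filling a i b (place w)
Admissible⇒Filling {w = w} (admissible tops ones twos lows ballot lat tbo) = record
  { lengthTop  = trans (length-positions isTop 1 w) tops
  ; lengthOne  = trans (length-positions isOne 1 w) ones
  ; lengthTwo  = trans (length-positions isTwo 1 w) twos
  ; lengthLow  = trans (length-positions isLow 1 w) lows
  ; increasing = λ x → positions-increasing (is x) 1 w
  ; top<one    = topBeforeOne⁺ 1 w tbo
  ; one<two    = ballot⁺ 1 w [] [] ballot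
  ; two<low    = lowAfterTwo⁺ 1 w lat
  ; bounds     = All.++⁺ (bound top) (All.++⁺ (bound one) (All.++⁺ (bound two) (bound low)))
  ; unique     = AllPairs.++⁺ (uniq top) (AllPairs.++⁺ (uniq one) (AllPairs.++⁺ (uniq two) (uniq low)
      (apart two low λ ()))
      (All.map (λ (p , q) → All.++⁺ p q) (All.zip (apart one two (λ ()) , apart one low λ ()))))
      (All.map (λ (p , q , r) → All.++⁺ p (All.++⁺ q r))
        (All.zip (apart top one (λ ()) , All.zip (apart top two (λ ()) , apart top low λ ()))))
  }
  where
  total : length w ≡ length (place w top ++ place w one ++ place w two ++ place w low)
  total = begin
    length w ≡⟨ length-counts w ⟩
    countᵇ isTop w + (countᵇ isOne w + (countᵇ isTwo w + countᵇ isLow w))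
      ≡⟨ cong₂ _+_ (length-positions isTop 1 w) (cong₂ _+_ (length-positions isOne 1 w)
           (cong₂ _+_ (length-positions isTwo 1 w) (length-positions isLow 1 w))) ⟨
    length (place w top) + (length (place w one) + (length (place w two) + length (place w low)))
      ≡⟨ cong (λ n → length (place w top) + (length (place w one) + n)) (length-++ (place w two)) ⟨
    length (place w top) + (length (place w one) + length (place w two ++ place w low))
      ≡⟨ cong (length (place w top) +_) (length-++ (place w one)) ⟨
    length (place w top) + length (place w one ++ place w two ++ place w low)
      ≡⟨ length-++ (place w top) ⟨
    length (place w top ++ place w one ++ place w two ++ place w low) ∎
    where open ≡-Reasoning
  bound : ∀ x → All
    (λ y → 1 ≤ y × y ≤ length (place w top ++ place w one ++ place w two ++ place w low)) (place w x)
  bound x = All.tabulate λ {y} y∈ → let 1≤y , y< = ∈-positions-bounds (is x) 1 w y∈ in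
    1≤y , subst (y ≤_) total (≤-pred y<)
  uniq : ∀ x → AllPairs _≢_ (place w x)
  uniq x = AllPairs.map <⇒≢ (positions-increasing (is x) 1 w)
  apart : ∀ x y → x ≢ y → All (λ p → All (p ≢_) (place w y)) (place w x)
  apart x y x≢y = All.tabulate λ p∈ → All.tabulate λ { q∈ refl →
    positions-disjoint (λ z xz yz → x≢y (trans (sym (is⇒≡ x z xz)) (is⇒≡ y z yz))) 1 w p∈ q∈ }

Filling⇒Admissible : ∀ {a i b L} → Filling a i b L →
  ∃ λ w → Admissible a (suc i) b w × (∀ x → place w x ≡ L x)
Filling⇒Admissible {a} {i} {b} {L} F = w , adm , place≡
  where
  open Filling F
  cls : ℕ → Letter
  cls y with _∈?_ _≟_ y (L top) | _∈?_ _≟_ y (L one) | _∈?_ _≟_ y (L two)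
  ... | yes _ | _     | _     = top
  ... | no _  | yes _ | _     = one
  ... | no _  | no _  | yes _ = two
  -- The default class. It is right for all entries by `sound`, and `Unique-covers` shows that each
  -- of 1, ..., N is an entry.
  ... | no _  | no _  | no _  = low
  unique₁ = Unique-++ʳ (L top) unique
  unique₂ = Unique-++ʳ (L one) unique₁
  sound : ∀ {y} → y ∈ entries → y ∈ L (cls y)
  sound {y} y∈ with _∈?_ _≟_ y (L top) | _∈?_ _≟_ y (L one) | _∈?_ _≟_ y (L two)
  ... | yes p | _     | _     = p
  ... | no _  | yes p | _     = p
  ... | no _  | no _  | yes p = p
  ... | no ¬t | no ¬o | no ¬w with ∈-++⁻ (L top) y∈
  ... | inj₁ p = contradiction p ¬t
  ... | inj₂ y∈₁ with ∈-++⁻ (L one) y∈₁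
  ... | inj₁ p = contradiction p ¬o
  ... | inj₂ y∈₂ with ∈-++⁻ (L two) y∈₂
  ... | inj₁ p = contradiction p ¬w
  ... | inj₂ p = p
  complete : ∀ x {y} → y ∈ L x → cls y ≡ x
  complete x {y} y∈ with _∈?_ _≟_ y (L top) | _∈?_ _≟_ y (L one) | _∈?_ _≟_ y (L two)
  complete top y∈ | yes _ | _     | _     = refl
  complete one y∈ | yes p | _     | _     = ⊥-elim (Unique-++-disjoint (L top) unique p (∈-++⁺ˡ y∈))
  complete two y∈ | yes p | _     | _     =
    ⊥-elim (Unique-++-disjoint (L top) unique p (∈-++⁺ʳ (L one) (∈-++⁺ˡ y∈)))
  complete low y∈ | yes p | _     | _     =
    ⊥-elim (Unique-++-disjoint (L top) unique p (∈-++⁺ʳ (L one) (∈-++⁺ʳ (L two) y∈)))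
  complete top y∈ | no ¬t | _     | _     = contradiction y∈ ¬t
  complete one y∈ | no _  | yes _ | _     = refl
  complete two y∈ | no _  | yes p | _     = ⊥-elim (Unique-++-disjoint (L one) unique₁ p (∈-++⁺ˡ y∈))
  complete low y∈ | no _  | yes p | _     =
    ⊥-elim (Unique-++-disjoint (L one) unique₁ p (∈-++⁺ʳ (L two) y∈))
  complete one y∈ | no _  | no ¬o | _     = contradiction y∈ ¬o
  complete two y∈ | no _  | no _  | yes _ = refl
  complete low y∈ | no _  | no _  | yes p = ⊥-elim (Unique-++-disjoint (L two) unique₂ p y∈)
  complete two y∈ | no _  | no _  | no ¬w = contradiction y∈ ¬w
  complete low y∈ | no _  | no _  | no _  = refl
  L⊆entries : ∀ x {y} → y ∈ L x → y ∈ entries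
  L⊆entries top y∈ = ∈-++⁺ˡ y∈
  L⊆entries one y∈ = ∈-++⁺ʳ (L top) (∈-++⁺ˡ y∈)
  L⊆entries two y∈ = ∈-++⁺ʳ (L top) (∈-++⁺ʳ (L one) (∈-++⁺ˡ y∈))
  L⊆entries low y∈ = ∈-++⁺ʳ (L top) (∈-++⁺ʳ (L one) (∈-++⁺ʳ (L two) y∈))
  w = map cls (range 1 (length entries))
  length-w : length w ≡ length entries
  length-w = trans (length-map cls (range 1 (length entries))) (length-range 1 (length entries))
  place≡ : ∀ x → place w x ≡ L x
  place≡ x = sorted-unique <-asym (<-irrefl refl) (positions-increasing (is x) 1 w) (increasing x)
    (λ {y} y∈ →
      let _ , isx   = positions-map⁻ (is x) cls 1 (length entries) y∈
          1≤y , y<  = ∈-positions-bounds (is x) 1 w y∈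
      in subst (λ x → y ∈ L x) (is⇒≡ x (cls y) isx)
           (sound (Unique-covers unique bounds 1≤y (subst (y ≤_) length-w (≤-pred y<)))))
    (λ {y} y∈ → let 1≤y , y≤n = All.lookup bounds (L⊆entries x y∈) in
      positions-map⁺ (is x) cls 1 (length entries) (∈-range 1≤y (s≤s y≤n))
        (subst (λ z → T (is x z)) (sym (complete x y∈)) (is-refl x)))
  count≡ : ∀ x → countᵇ (is x) w ≡ length (L x)
  count≡ x = trans (sym (length-positions (is x) 1 w)) (cong length (place≡ x))
  adm : Admissible a (suc i) b w
  adm = admissible (trans (count≡ top) lengthTop) (trans (count≡ one) lengthOne)
    (trans (count≡ two) lengthTwo) (trans (count≡ low) lengthLow)
    (ballot⁻ 1 w [] [] (subst₂ (Pointwise _<_) (sym (place≡ one)) (sym (place≡ two)) one<two))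
    (lowAfterTwo⁻ 1 w (subst₂ (λ Y C → All (λ y → Any (_< y) Y) C)
      (sym (place≡ two)) (sym (place≡ low)) two<low))
    (topBeforeOne⁻ 1 w (subst₂ (λ X A → All (λ y → Any (y <_) X) A)
      (sym (place≡ one)) (sym (place≡ top)) top<one))

-- Tableaux

tableau : (A X Y C : List ℕ) → List (List ℕ)
tableau A X Y C = map [_] A ++ X ∷ Y ∷ map [_] C

byLetter : (A X Y C : List ℕ) → Letter → List ℕ
byLetter A X Y C top = A
byLetter A X Y C one = X
byLetter A X Y C two = Y
byLetter A X Y C low = C

concat-tableau : ∀ A X Y C → concat (tableau A X Y C) ≡ A ++ X ++ Y ++ C
concat-tableau []      X Y C = cong (λ zs → X ++ Y ++ zs) (concat-map-[_] C)
concat-tableau (x ∷ A) X Y C = cong (x ∷_) (concat-tableau A X Y C)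

-- If the long rows have length 1, nothing in the list of rows shows where `A` ends; hence the
-- equation on lengths.
tableau-injective : ∀ A {X Y C} A′ {X′ Y′ C′} → length A ≡ length A′ →
  tableau A X Y C ≡ tableau A′ X′ Y′ C′ → ∀ x → byLetter A X Y C x ≡ byLetter A′ X′ Y′ C′ x
tableau-injective []      []        len eq x with ∷-injective eq
... | refl , eq′ with ∷-injective eq′
... | refl , eq″ with map-injective ∷-injectiveˡ eq″
... | refl = refl
tableau-injective (y ∷ A) (y′ ∷ A′) len eq x with ∷-injective eq
... | refl , eq′ = extend x (tableau-injective A A′ (suc-injective len) eq′ x)
  where
  extend : ∀ x {X Y C X′ Y′ C′} → byLetter A X Y C x ≡ byLetter A′ X′ Y′ C′ x →
    byLetter (y ∷ A) X Y C x ≡ byLetter (y ∷ A′) X′ Y′ C′ x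
  extend top = cong (y ∷_)
  extend one = id
  extend two = id
  extend low = id

-- Reflection of the tests on rows and entries

all-upTo⁻ : ∀ (f : ℕ → Bool) n → T (all f (upTo n)) → ∀ {r} → r < n → T (f r)
all-upTo⁻ f n p r<n = All.lookup (All.all⁺ f (upTo n) p) (∈-upTo⁺ r<n)

all-upTo⁺ : ∀ (f : ℕ → Bool) n → (∀ {r} → r < n → T (f r)) → T (all f (upTo n))
all-upTo⁺ f n p = All.all⁻ f (All.tabulate (p ∘ ∈-upTo⁻))

strictIncᵇ⁻ : ∀ xs → T (strictIncᵇ xs) → AllPairs _<_ xs
strictIncᵇ⁻ []           p = []
strictIncᵇ⁻ (x ∷ [])     p = [] ∷ []
strictIncᵇ⁻ (x ∷ y ∷ xs) p = let x<y , q = ∧⁻ {x <ᵇ y} p in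
  AllPairs-∷ <-trans (<ᵇ⇒< x y x<y) (strictIncᵇ⁻ (y ∷ xs) q)

strictIncᵇ⁺ : ∀ xs → AllPairs _<_ xs → T (strictIncᵇ xs)
strictIncᵇ⁺ []           []                       = _
strictIncᵇ⁺ (x ∷ [])     (_ ∷ [])                 = _
strictIncᵇ⁺ (x ∷ y ∷ xs) ((x<y ∷ _) ∷ y<xs ∷ xs<) = ∧⁺ (<⇒<ᵇ x<y) (strictIncᵇ⁺ (y ∷ xs) (y<xs ∷ xs<))

elemᵇ⁺ : ∀ {x ys} → x ∈ ys → T (elemᵇ x ys)
elemᵇ⁺ {x} {y ∷ _} (here refl) = ∨⁺ {x ≡ᵇ y} (inj₁ (≡⇒≡ᵇ x y refl))
elemᵇ⁺ {x} {y ∷ _} (there x∈)  = ∨⁺ {x ≡ᵇ y} (inj₂ (elemᵇ⁺ x∈))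

elemᵇ⁻ : ∀ x ys → T (elemᵇ x ys) → x ∈ ys
elemᵇ⁻ x (y ∷ ys) p = [ here ∘ ≡ᵇ⇒≡ x y , there ∘ elemᵇ⁻ x ys ]′ (∨⁻ {x ≡ᵇ y} p)

distinctᵇ⁻ : ∀ xs → T (distinctᵇ xs) → AllPairs _≢_ xs
distinctᵇ⁻ []       p = []
distinctᵇ⁻ (x ∷ xs) p = let q , r = ∧⁻ {not (elemᵇ x xs)} p in
  All.tabulate (λ y∈ x≡y → not⁻ q (elemᵇ⁺ (subst (_∈ xs) (sym x≡y) y∈))) ∷ distinctᵇ⁻ xs r

distinctᵇ⁺ : ∀ {xs} → AllPairs _≢_ xs → T (distinctᵇ xs)
distinctᵇ⁺ []                    = _
distinctᵇ⁺ {x ∷ xs} (x∉ ∷ uniq) = ∧⁺ (not⁺ (λ p → All.lookup x∉ (elemᵇ⁻ x xs p) refl)) (distinctᵇ⁺ uniq)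

-- Shape

RowLengths : List ℕ → List ℕ → List (List ℕ) → Set
RowLengths λ′ μ t = length t ≡ length λ′ ×
  (∀ {r} → r < length λ′ → length (rowAt t r) ≡ at λ′ r ∸ at μ r)

hasShapeᵇ⁻ : ∀ λ′ μ t → T (hasShapeᵇ λ′ μ t) → RowLengths λ′ μ t
hasShapeᵇ⁻ λ′ μ t p = let q , r = ∧⁻ {length t ≡ᵇ length λ′} p in
  ≡ᵇ⇒≡ (length t) (length λ′) q , λ {j} j< → ≡ᵇ⇒≡ (length (rowAt t j)) _ (all-upTo⁻ _ (length λ′) r j<)

hasShapeᵇ⁺ : ∀ λ′ μ t → RowLengths λ′ μ t → T (hasShapeᵇ λ′ μ t)
hasShapeᵇ⁺ λ′ μ t (len , rows) = ∧⁺ (≡⇒≡ᵇ (length t) (length λ′) len)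
  (all-upTo⁺ _ (length λ′) (λ {r} r< → ≡⇒≡ᵇ (length (rowAt t r)) _ (rows r<)))

singleton : {row : List ℕ} → length row ≡ 1 → ∃ λ x → row ≡ [ x ]
singleton {x ∷ []} _ = x , refl

RowLengths-ones⁻ : ∀ a t → RowLengths (replicate a 1) [] t → ∃ λ C → t ≡ map [_] C × length C ≡ a
RowLengths-ones⁻ zero    []        _            = [] , refl , refl
RowLengths-ones⁻ (suc a) (row ∷ t) (len , rows)
  with singleton {row} (rows (s≤s z≤n)) | RowLengths-ones⁻ a t (suc-injective len , λ r< → rows (s≤s r<))
... | x , refl | C , refl , refl = x ∷ C , refl , refl

RowLengths-ones⁺ : ∀ C → RowLengths (replicate (length C) 1) [] (map [_] C)
RowLengths-ones⁺ []      = refl , λ ()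
RowLengths-ones⁺ (x ∷ C) = let len , rows = RowLengths-ones⁺ C in cong suc len ,
  λ { {zero} _ → refl ; {suc r} (s≤s r<) → rows r< }

RowLengths⁻ : ∀ a i b t → RowLengths (skewOuter (2 + a) i (2 + b)) (skewInner (2 + a) i (2 + b)) t →
  ∃ λ A → ∃ λ X → ∃ λ Y → ∃ λ C → t ≡ tableau A X Y C ×
    length A ≡ b × length X ≡ suc i × length Y ≡ suc i × length C ≡ a
RowLengths⁻ a i zero    (X ∷ Y ∷ t) (len , rows)
  with RowLengths-ones⁻ a t (suc-injective (suc-injective len) , λ r< → rows (s≤s (s≤s r<)))
... | C , refl , refl = [] , X , Y , C , refl , refl , rows (s≤s z≤n) , rows (s≤s (s≤s z≤n)) , refl
RowLengths⁻ a i (suc b) (row ∷ t)   (len , rows)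
  with singleton {row} (trans (rows (s≤s z≤n)) (m+n∸n≡m 1 i))
     | RowLengths⁻ a i b t (suc-injective len , λ r< → rows (s≤s r<))
... | x , refl | A , X , Y , C , refl , lenA , lens = x ∷ A , X , Y , C , refl , cong suc lenA , lens

RowLengths⁺ : ∀ {i} A X Y C → length X ≡ suc i → length Y ≡ suc i →
  RowLengths (skewOuter (2 + length C) i (2 + length A)) (skewInner (2 + length C) i (2 + length A))
    (tableau A X Y C)
RowLengths⁺ []      X Y C lenX lenY = let len , rows = RowLengths-ones⁺ C in cong (suc ∘ suc) len ,
  λ { {zero} _ → lenX ; {suc zero} _ → lenY ; {suc (suc r)} (s≤s (s≤s r<)) → rows r< }
RowLengths⁺ {i} (x ∷ A) X Y C lenX lenY =
  let len , rows = RowLengths⁺ A X Y C lenX lenY in cong suc len ,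
  λ { {zero} _ → sym (m+n∸n≡m 1 i) ; {suc r} (s≤s r<) → rows r< }

-- Columns

lookupM-∈ : ∀ X {j} → j < length X → ∃ λ z → lookupM X j ≡ just z × z ∈ X
lookupM-∈ (x ∷ X) {zero}  _        = x , refl , here refl
lookupM-∈ (x ∷ X) {suc j} (s≤s j<) = let z , eq , z∈ = lookupM-∈ X j< in z , eq , there z∈

lookupM-last : ∀ {i} X y → length X ≡ suc i → AllPairs _<_ X → Any (y <_) X →
  ∃ λ z → lookupM X i ≡ just z × y < z
lookupM-last (x ∷ [])     y refl inc            (here y<x)  = x , refl , y<x
lookupM-last (x ∷ z ∷ X) y refl ((x<z ∷ _) ∷ inc) (here y<x) =
  lookupM-last (z ∷ X) y refl inc (here (<-trans y<x x<z))
lookupM-last (x ∷ z ∷ X) y refl (_ ∷ inc)         (there p)  = lookupM-last (z ∷ X) y refl inc p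

Descends : List ℕ → List (List ℕ) → ℕ → ℕ → Set
Descends μ t r c = T (below<ᵇ (entry μ t r c) (entry μ t (suc r) c))

below<ᵇ-nothing : ∀ e → T (below<ᵇ e nothing)
below<ᵇ-nothing nothing  = _
below<ᵇ-nothing (just _) = _

entry-left : ∀ {i c} μ row t → c < i → entry (i ∷ μ) (row ∷ t) 0 c ≡ nothing
entry-left μ row t c<i = if-true (<⇒<ᵇ c<i)

entry-single : ∀ i μ x t → entry (i ∷ μ) ([ x ] ∷ t) 0 i ≡ just x
entry-single i μ x t = trans (if-false (λ p → <-irrefl refl (<ᵇ⇒< i i p)))
  (cong (lookupM [ x ]) (n∸n≡0 i))

column⁻ : ∀ y ys C → (∀ {r} → r < length C → Descends [] ((y ∷ ys) ∷ map [_] C) r 0) →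
  AllPairs _<_ (y ∷ C)
column⁻ y ys []      desc = [] ∷ []
column⁻ y ys (z ∷ C) desc =
  AllPairs-∷ <-trans (<ᵇ⇒< y z (desc (s≤s z≤n))) (column⁻ z [] C (λ r< → desc (s≤s r<)))

column⁺ : ∀ y ys C → AllPairs _<_ (y ∷ C) → ∀ r c → Descends [] ((y ∷ ys) ∷ map [_] C) r c
column⁺ y ys []      _                       zero    c       = below<ᵇ-nothing (lookupM (y ∷ ys) c)
column⁺ y ys []      _                       (suc r) c       = _
column⁺ y ys (z ∷ C) ((y<z ∷ _) ∷ _)         zero    zero    = <⇒<ᵇ y<z
column⁺ y ys (z ∷ C) _                       zero    (suc c) = below<ᵇ-nothing (lookupM ys c)
column⁺ y ys (z ∷ C) (_ ∷ inc)               (suc r) c       = column⁺ z [] C inc r c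

rows⁻ : ∀ X Y → length X ≡ length Y →
  (∀ {c} → c < length X → T (below<ᵇ (lookupM X c) (lookupM Y c))) → Pointwise _<_ X Y
rows⁻ []      []      len desc = []
rows⁻ (x ∷ X) (y ∷ Y) len desc =
  <ᵇ⇒< x y (desc (s≤s z≤n)) ∷ rows⁻ X Y (suc-injective len) (λ c< → desc (s≤s c<))

rows⁺ : ∀ {X Y} → Pointwise _<_ X Y → ∀ c → T (below<ᵇ (lookupM X c) (lookupM Y c))
rows⁺ []          c       = _
rows⁺ (x<y ∷ _)   zero    = <⇒<ᵇ x<y
rows⁺ (_ ∷ X<Y)   (suc c) = rows⁺ X<Y c

-- Above the long rows only column `i` has boxes. The lowest of them is compared with the last entry
-- of `X`, and transitivity carries this bound up the column.
columns⁻ : ∀ {i} A X Y C → length X ≡ suc i → length Y ≡ suc i →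
  (∀ {r c} → r < 2 + length A + length C → c < suc i →
    Descends (replicate (length A) i) (tableau A X Y C) r c) →
  AllPairs _<_ A × All (λ y → Any (y <_) X) A × Pointwise _<_ X Y ×
  AllPairs _<_ C × All (λ y → Any (_< y) Y) C
columns⁻ {i} []      X (y ∷ Y) C lenX lenY desc
  with column⁻ y Y C (λ r< → desc (s≤s (m≤n⇒m≤1+n r<)) (s≤s z≤n))
... | y<C ∷ inc = [] , [] ,
  rows⁻ X (y ∷ Y) (trans lenX (sym lenY)) (λ {c} c< → desc (s≤s z≤n) (subst (c <_) lenX c<)) ,
  inc , All.map here y<C
columns⁻ {i} (x ∷ A) X Y C lenX lenY desc
  with columns⁻ A X Y C lenX lenY (λ r< c< → desc (s≤s r<) c<) | desc {0} {i} (s≤s z≤n) ≤-refl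
... | incA , A<X , rest | x<next
  rewrite entry-single i (replicate (length A) i) x (tableau A X Y C) = next A incA A<X x<next
  where
  next : ∀ A → AllPairs _<_ A → All (λ y → Any (y <_) X) A →
    T (below<ᵇ (just x) (entry (replicate (length A) i) (tableau A X Y C) 0 i)) →
    AllPairs _<_ (x ∷ A) × All (λ y → Any (y <_) X) (x ∷ A) × _
  next []       incA A<X p with lookupM-∈ X {i} (≤-reflexive (sym lenX))
  ... | z , eq , z∈ rewrite eq = [] ∷ [] , lose z∈ (<ᵇ⇒< x z p) ∷ [] , rest
  next (x′ ∷ A) incA A<X@(x′<X ∷ _) p
    rewrite entry-single i (replicate (length A) i) x′ (tableau A X Y C) =
    AllPairs-∷ <-trans (<ᵇ⇒< x x′ p) incA , Any.map (<-trans (<ᵇ⇒< x x′ p)) x′<X ∷ A<X , rest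

-- As the rows increase, a bound by some entry of `X` sharpens to its last entry, and a bound by
-- some entry of `Y` to its first; these are the entries that the column test compares. Cells
-- outside the diagram are `nothing` and pass.
columns⁺ : ∀ {i} A X Y C → length X ≡ suc i → length Y ≡ suc i →
  AllPairs _<_ X → AllPairs _<_ Y →
  AllPairs _<_ A → All (λ y → Any (y <_) X) A → Pointwise _<_ X Y →
  AllPairs _<_ C → All (λ y → Any (_< y) Y) C →
  ∀ r {c} → c < suc i → Descends (replicate (length A) i) (tableau A X Y C) r c
columns⁺ [] X Y C lenX lenY incX incY incA A<X X<Y incC Y<C zero {c} c< = rows⁺ X<Y c
columns⁺ [] X (y ∷ Y) C lenX lenY incX (y<Y ∷ _) incA A<X X<Y incC Y<C (suc r) {c} c< =
  column⁺ y Y C (All.map head< Y<C ∷ incC) r c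
  where
  head< : ∀ {z} → Any (_< z) (y ∷ Y) → y < z
  head< (here y<z)  = y<z
  head< (there any) = let _ , v∈ , v<z = find any in <-trans (All.lookup y<Y v∈) v<z
columns⁺ (x ∷ A) X Y C lenX lenY incX incY (_ ∷ incA) (_ ∷ A<X) X<Y incC Y<C (suc r) c< =
  columns⁺ A X Y C lenX lenY incX incY incA A<X X<Y incC Y<C r c<
columns⁺ {i} (x ∷ A) X Y C lenX lenY incX incY incA A<X X<Y incC Y<C zero {c} (s≤s c≤i)
  with m≤n⇒m<n∨m≡n c≤i
... | inj₁ c<i rewrite entry-left (replicate (length A) i) [ x ] (tableau A X Y C) c<i = _
... | inj₂ refl rewrite entry-single i (replicate (length A) i) x (tableau A X Y C) = next A incA A<X
  where
  next : ∀ A → AllPairs _<_ (x ∷ A) → All (λ y → Any (y <_) X) (x ∷ A) →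
    T (below<ᵇ (just x) (entry (replicate (length A) i) (tableau A X Y C) 0 i))
  next []       _               (x<X ∷ _) with lookupM-last X x lenX incX x<X
  ... | z , eq , x<z rewrite eq = <⇒<ᵇ x<z
  next (x′ ∷ A) ((x<x′ ∷ _) ∷ _) _
    rewrite entry-single i (replicate (length A) i) x′ (tableau A X Y C) = <⇒<ᵇ x<x′

colsIncᵇ⁻ : ∀ λ′ μ t → T (colsIncᵇ λ′ μ t) →
  ∀ {r c} → r < length λ′ → c < at λ′ 0 → Descends μ t r c
colsIncᵇ⁻ λ′ μ t p {r} r< c< = all-upTo⁻ (below r) (at λ′ 0)
  (all-upTo⁻ (λ r → all (below r) (upTo (at λ′ 0))) (length λ′) p r<) c<
  where
  below : ℕ → ℕ → Bool
  below r c = below<ᵇ (entry μ t r c) (entry μ t (suc r) c)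

colsIncᵇ⁺ : ∀ λ′ μ t → (∀ r {c} → c < at λ′ 0 → Descends μ t r c) → T (colsIncᵇ λ′ μ t)
colsIncᵇ⁺ λ′ μ t desc = all-upTo⁺ (λ r → all (below r) (upTo (at λ′ 0))) (length λ′)
  (λ {r} _ → all-upTo⁺ (below r) (at λ′ 0) (desc r))
  where
  below : ℕ → ℕ → Bool
  below r c = below<ᵇ (entry μ t r c) (entry μ t (suc r) c)

-- The bijection between tableaux and paths

length-outer : ∀ a i b → length (skewOuter (2 + a) i (2 + b)) ≡ 2 + b + a
length-outer a i b = trans (length-++ (replicate (2 + b) (suc i)))
  (cong₂ _+_ (length-replicate (2 + b)) (length-replicate a))

skytᵇ : ℕ → ℕ → ℕ → List (List ℕ) → Bool
skytᵇ a i b = isStandardSkewᵇ (skewOuter (2 + a) i (2 + b)) (skewInner (2 + a) i (2 + b))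

skytᵇ⁻ : ∀ a i b t → T (skytᵇ a i b t) →
  ∃ λ A → ∃ λ X → ∃ λ Y → ∃ λ C → t ≡ tableau A X Y C × Filling a i b (byLetter A X Y C)
skytᵇ⁻ a i b t p with ∧⁻ {hasShapeᵇ (skewOuter (2 + a) i (2 + b)) (skewInner (2 + a) i (2 + b)) t} p
... | shape , p₁ with ∧⁻ {rowsIncᵇ t} p₁
... | rows , p₂ with ∧⁻ {colsIncᵇ (skewOuter (2 + a) i (2 + b)) (skewInner (2 + a) i (2 + b)) t} p₂
... | cols , p₃ with ∧⁻ {all (λ x → (1 ≤ᵇ x) ∧ (x ≤ᵇ length (concat t))) (concat t)} p₃
... | bounds , distinct with RowLengths⁻ a i b t
  (hasShapeᵇ⁻ (skewOuter (2 + a) i (2 + b)) (skewInner (2 + a) i (2 + b)) t shape)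
... | A , X , Y , C , refl , refl , lenX , lenY , refl
  with columns⁻ A X Y C lenX lenY (λ {r} {c} r< c< →
         colsIncᵇ⁻ (skewOuter (2 + a) i (2 + b)) (skewInner (2 + a) i (2 + b)) t cols
           (subst (r <_) (sym (length-outer a i b)) r<) c<)
     | All.++⁻ʳ (map [_] A) (All.all⁺ strictIncᵇ t rows)
... | incA , A<X , X<Y , incC , Y<C | incX ∷ incY ∷ _ = A , X , Y , C , refl , record
  { lengthTop  = refl
  ; lengthOne  = lenX
  ; lengthTwo  = lenY
  ; lengthLow  = refl
  ; increasing = λ { top → incA ; one → strictIncᵇ⁻ X incX ; two → strictIncᵇ⁻ Y incY ; low → incC }
  ; top<one    = A<X
  ; one<two    = X<Y
  ; two<low    = Y<C
  ; bounds     = subst (λ zs → All (λ x → 1 ≤ x × x ≤ length zs) zs) (concat-tableau A X Y C)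
      (All.map (λ {x} q → let q₁ , q₂ = ∧⁻ {1 ≤ᵇ x} q in ≤ᵇ⇒≤ 1 x q₁ , ≤ᵇ⇒≤ x _ q₂)
        (All.all⁺ (λ x → (1 ≤ᵇ x) ∧ (x ≤ᵇ length (concat t))) (concat t) bounds))
  ; unique     = subst (AllPairs _≢_) (concat-tableau A X Y C) (distinctᵇ⁻ (concat t) distinct)
  }

skytᵇ⁺ : ∀ {a i b} L → Filling a i b L → T (skytᵇ a i b (tableau (L top) (L one) (L two) (L low)))
skytᵇ⁺ {a} {i} {b} L F with Filling.lengthTop F | Filling.lengthLow F
... | refl | refl =
  ∧⁺ {hasShapeᵇ λ′ μ t} (hasShapeᵇ⁺ λ′ μ t (RowLengths⁺ A X Y C lengthOne lengthTwo))
  (∧⁺ {rowsIncᵇ t} (All.all⁻ strictIncᵇ (All.++⁺ (singles A)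
        (strictIncᵇ⁺ X (increasing one) ∷ strictIncᵇ⁺ Y (increasing two) ∷ singles C)))
  (∧⁺ {colsIncᵇ λ′ μ t} (colsIncᵇ⁺ λ′ μ t
        (columns⁺ A X Y C lengthOne lengthTwo (increasing one) (increasing two)
          (increasing top) top<one one<two (increasing low) two<low))
  (∧⁺ (All.all⁻ (λ x → (1 ≤ᵇ x) ∧ (x ≤ᵇ length (concat t)))
        (All.map (λ (1≤x , x≤n) → ∧⁺ (≤⇒≤ᵇ 1≤x) (≤⇒≤ᵇ x≤n))
          (subst (λ zs → All (λ x → 1 ≤ x × x ≤ length zs) zs) (sym (concat-tableau A X Y C)) bounds)))
      (distinctᵇ⁺ (subst (AllPairs _≢_) (sym (concat-tableau A X Y C)) unique)))))
  where
  open Filling F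
  A = L top
  X = L one
  Y = L two
  C = L low
  t = tableau A X Y C
  λ′ = skewOuter (2 + length C) i (2 + length A)
  μ = skewInner (2 + length C) i (2 + length A)
  singles : ∀ zs → All (T ∘ strictIncᵇ) (map [_] zs)
  singles []       = []
  singles (_ ∷ zs) = _ ∷ singles zs

tableauOf : List Letter → List (List ℕ)
tableauOf w = tableau (place w top) (place w one) (place w two) (place w low)

byLetter-place : ∀ w x → byLetter (place w top) (place w one) (place w two) (place w low) x ≡ place w x
byLetter-place w top = refl
byLetter-place w one = refl
byLetter-place w two = refl
byLetter-place w low = refl

tableauOf-injective : ∀ {w w′} → countᵇ isTop w ≡ countᵇ isTop w′ → tableauOf w ≡ tableauOf w′ → w ≡ w′
tableauOf-injective {w} {w′} count≡ eq = positions-injective 1 w w′ λ x →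
  trans (sym (byLetter-place w x)) (trans (tableau-injective (place w top) (place w′ top)
    (trans (length-positions isTop 1 w) (trans count≡ (sym (length-positions isTop 1 w′)))) eq x)
    (byLetter-place w′ x))

Skyt↔Dyck : ∀ a i b → Skyt (2 + a) i (2 + b) ↔ Dyck (a + (2 + b) + 2 * i) (suc i) b
Skyt↔Dyck a i b = relation-↔ {P = skytᵇ a i b} {Q = dyckᵇ (a + (2 + b) + 2 * i) (suc i) b}
  R toDyck toSkyt
  (λ { (w , adm , refl , code) (w′ , adm′ , eq , code′) →
    Codes-functional code (subst (λ w → Codes w _)
      (tableauOf-injective (trans (Admissible.tops adm′) (sym (Admissible.tops adm))) (sym eq)) code′) })
  (λ { (w , _ , refl , code) (w′ , _ , refl , code′) → cong tableauOf (Codes-injective code code′) })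
  where
  R : List (List ℕ) → List Step → Set
  R t p = ∃ λ w → Admissible a (suc i) b w × t ≡ tableauOf w × Codes w p

  toDyck : ∀ t → T (skytᵇ a i b t) → ∃ λ p → T (dyckᵇ (a + (2 + b) + 2 * i) (suc i) b p) × R t p
  toDyck t valid with skytᵇ⁻ a i b t valid
  ... | A , X , Y , C , refl , F with Filling⇒Admissible F
  ... | w , adm , place≡ with Admissible⇒Dyck adm
  ... | p , dyck , code = p , dyck , w , adm , tableau≡ , code
    where
    tableau≡ : tableau A X Y C ≡ tableauOf w
    tableau≡ rewrite place≡ top | place≡ one | place≡ two | place≡ low = refl

  toSkyt : ∀ p → T (dyckᵇ (a + (2 + b) + 2 * i) (suc i) b p) → ∃ λ t → T (skytᵇ a i b t) × R t p
  toSkyt p dyck with Dyck⇒Admissible a i b p dyck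
  ... | w , adm , code = tableauOf w , skytᵇ⁺ (place w) (Admissible⇒Filling adm) , w , adm , refl , code

mainTheorem1 : (a i b : ℕ) → 2 ≤ a → 2 ≤ b →
    (Skyt a i b ↔ Dyck (a + b + 2 * i ∸ 2) (suc i) (b ∸ 2))
    × (Dyck (a + b + 2 * i ∸ 2) (suc i) (b ∸ 2) ↔ Tri (a + b + 2 * i) (suc i) (b ∸ 2))
-- Once both parameters are at least 2 by their form, the truncated subtractions compute, and the
-- polygon visibly has two vertices more than the semi-length.
mainTheorem1 (suc (suc a)) i (suc (suc b)) (s≤s (s≤s z≤n)) (s≤s (s≤s z≤n)) =
  Skyt↔Dyck a i b , Dyck↔Tri (a + (2 + b) + 2 * i) (suc i) b
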